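{- Let $K$ be a number field and $p\geq 2$ a prime number such that the Leopoldt conjecture holds for $p$ in $K$. Let $\kappa_K$ be the Kummer--Leopoldt constant of $K$ at $p$, and let $p^\nu$ be the exponent of $\mathcal{W}_K:=W_K/\mu_K$, where $W_K=\mathrm{tor}_{\mathbb{Z}_p}(U_K)$ and $\mu_K$ is the group of global roots of unity of $K$ of $p$-power order. (i) If $\nu\geq 1$, then for all $n\geq 0$, any $\varepsilon\in E_K$ such that $\varepsilon\in U_K^{p^{n+\kappa_K}}$ is necessarily of the form $\varepsilon=\zeta\cdot\eta^{p^n}$ with $\zeta\in\mu_K\cap W_K^{p^n}$ and $\eta\in E_K$. (ii) If $\nu=0$, then for all $n\geq 0$, any $\varepsilon\in E_K$ such that $\varepsilon\in U_K^{p^{n+\kappa_K}}$ is necessarily in $E_K^{p^n}$.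
   Context: Let $K$ be a number field and $p\ge 2$ a prime. For each prime ideal $\mathfrak{p}\mid p$ of $K$ let $K_{\mathfrak{p}}$ be the completion and $\overline{\mathfrak{p}}$ the maximal ideal of its ring of integers. - $E_K$ is the group of $p$-principal global units of $K$: units $\varepsilon$ of the ring of integers of $K$ with $\varepsilon\equiv 1 \pmod{\prod_{\mathfrak{p}\mid p}\mathfrak{p}}$. - $U_K := \{u\in \bigoplus_{\mathfrak{p}\mid p}K_{\mathfrak{p}}^\times : u=1+x,\ x\in\bigoplus_{\mathfrak{p}\mid p}\overline{\mathfrak{p}}\}$, the (multiplicatively written) $\mathbb{Z}_p$-module of principal local units at $p$; $W_K$ is its $\mathbb{Z}_p$-torsion subgroup. - $E_K$ (in particular $\mu_K\subset E_K$) is embedded diagonally in $U_K$ (this embedding is understood everywhere), and $\overline{E}_K$ is the topological closure of $E_K$ in $U_K$, i.e. the image of $E_K\otimes\mathbb{Z}_p\to U_K$. - The Leopoldt conjecture for $p$ in $K$ is the condition $\mathrm{rk}_{\mathbb{Z}_p}(\overline{E}_K)=\mathrm{rk}_{\mathbb{Z}}(E_K)$. - Kummer--Leopoldt constant (under the Leopoldt conjecture for $p$ in $K$): $\kappa_K$ is the smallest integer $c\geq 0$ such that for all sufficiently large $n$, any unit $\varepsilon\in E_K$ such that $\varepsilon\in U_K^{p^{n+c}}$ is necessarily in $E_K^{p^n}$. - For an abelian group $A$ written multiplicatively, $A^{p^m}$ denotes the subgroup of $p^m$-th powers. -}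

module Defs where

open import Algebra.Apartness.Bundles using (HeytingField)
open import Algebra.Bundles using (CommutativeRing; Semiring)
open import Algebra.Morphism.Structures using (module RingMorphisms)
import Algebra.Apartness.Bundles as Apartness
import Algebra.Definitions.RawSemiring as RawSemiringOps
open import Data.Fin.Base using (Fin; toℕ)
open import Data.Integer.Base as ℤ using (ℤ; +_)
open import Data.Nat.Base as ℕ using (ℕ; zero; suc)
open import Data.Nat.Divisibility using (_∣_)
open import Data.Product.Base using (Σ; ∃-syntax; _×_)
open import Data.Rational.Base as ℚ using (ℚ; 0ℚ)
open import Data.Sum.Base using (_⊎_)
open import Data.Vec.Functional using (Vector; foldr)
open import Function.Bundles using (_⇔_)
open import Level using (0ℓ)
open import Relation.Binary.PropositionalEquality.Core using (_≡_; _≢_; _≗_)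
open import Relation.Nullary.Negation.Core using (¬_)
open import Relation.Unary using (Pred; _∈_; _∉_; _⊆_; _≐_)

------------------------------------------------------------------------
-- Fields

Field : Set₁
Field = HeytingField 0ℓ 0ℓ 0ℓ

module FieldOps (F : Field) where
  open HeytingField F public

  commutativeRing : CommutativeRing 0ℓ 0ℓ
  commutativeRing =
    Apartness.HeytingCommutativeRing.commutativeRing heytingCommutativeRing

  open CommutativeRing commutativeRing public using (rawRing; semiring)
  open Semiring semiring public using (rawSemiring)
  open RawSemiringOps rawSemiring public using (_^_; sum; product)

record NumberField : Set₁ where
  field
    field′ : Field

  open FieldOps field′ public

  field
    fromℚ       : ℚ → Carrier
    fromℚ-homo  : RingMorphisms.IsRingHomomorphism ℚ.+-*-rawRing rawRing fromℚ
    degree      : ℕ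
    basis       : Vector Carrier degree
    spanning    : ∀ x → Σ (Vector ℚ degree) λ q →
                  x ≈ sum (λ i → fromℚ (q i) * basis i)
    independent : ∀ (q : Vector ℚ degree) →
                  sum (λ i → fromℚ (q i) * basis i) ≈ 0# →
                  ∀ i → q i ≡ 0ℚ

  fromℤ : ℤ → Carrier
  fromℤ z = fromℚ (z ℚ./ 1)

  -- The ring of integers, as a subset of the field: the elements
  -- annihilated by a monic polynomial with integer coefficients c.
  𝒪 : Pred Carrier 0ℓ
  𝒪 x = ∃[ n ] Σ (Vector ℤ n) λ c →
        x ^ n + sum (λ i → fromℤ (c i) * x ^ toℕ i) ≈ 0#

------------------------------------------------------------------------
-- Ideals of the ring of integers

module _ (K : NumberField) where
  open NumberField K

  record IsPrimeIdeal (I : Pred Carrier 0ℓ) : Set where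
    field
      ⊆𝒪       : I ⊆ 𝒪
      resp-≈   : ∀ {x y} → x ≈ y → x ∈ I → y ∈ I
      0∈       : 0# ∈ I
      +-closed : ∀ {x y} → x ∈ I → y ∈ I → x + y ∈ I
      *-closed : ∀ {r x} → r ∈ 𝒪 → x ∈ I → r * x ∈ I
      1∉       : 1# ∉ I
      prime    : ∀ {x y} → x ∈ 𝒪 → y ∈ 𝒪 → x * y ∈ I → x ∈ I ⊎ y ∈ I

  idealProduct : Pred Carrier 0ℓ → Pred Carrier 0ℓ → Pred Carrier 0ℓ
  idealProduct I J x =
    ∃[ n ] Σ (Vector Carrier n) λ a → Σ (Vector Carrier n) λ b →
      (∀ i → a i ∈ I) × (∀ i → b i ∈ J) × x ≈ sum (λ i → a i * b i)

  idealPower : Pred Carrier 0ℓ → ℕ → Pred Carrier 0ℓ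
  idealPower I zero    = 𝒪
  idealPower I (suc n) = idealProduct I (idealPower I n)

  -- A repetition-free enumeration of all the prime ideals above p.  As
  -- these ideals are maximal, two of them are different exactly when the
  -- first has an element outside the second.
  record PrimesAbove (p : ℕ) : Set₁ where
    field
      count    : ℕ
      𝔭        : Fin count → Pred Carrier 0ℓ
      isPrime  : ∀ i → IsPrimeIdeal (𝔭 i)
      above    : ∀ i → fromℤ (+ p) ∈ 𝔭 i
      distinct : ∀ i j → i ≢ j → ∃[ x ] x ∈ 𝔭 i × x ∉ 𝔭 j
      all      : ∀ (𝔮 : Pred Carrier 0ℓ) → IsPrimeIdeal 𝔮 →
                 fromℤ (+ p) ∈ 𝔮 → ∃[ i ] 𝔮 ≐ 𝔭 i

    ∏𝔭 : Pred Carrier 0ℓ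
    ∏𝔭 = foldr idealProduct 𝒪 𝔭

  -- The completion of K at 𝔭, given by the properties that determine it
  -- up to unique isomorphism: a complete field with a discrete valuation,
  -- in which K is dense, and whose valuation extends the 𝔭-adic one.
  record Completion (𝔭 : Pred Carrier 0ℓ) : Set₁ where
    field
      field^ : Field

    module ^ = FieldOps field^

    field
      ι      : Carrier → ^.Carrier
      ι-homo : RingMorphisms.IsRingHomomorphism rawRing ^.rawRing ι
      val    : ∀ x → x ^.# ^.0# → ℤ

    -- "val x ≥ n", with val 0 = ∞.
    Val≥ : ℤ → Pred ^.Carrier 0ℓ
    Val≥ n x = ∀ x#0 → n ℤ.≤ val x x#0

    Near : ℕ → ^.Carrier → ^.Carrier → Set
    Near n x y = Val≥ (+ n) (x ^.- y)

    Limit : (ℕ → ^.Carrier) → ^.Carrier → Set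
    Limit s x = ∀ N → ∃[ M ] ∀ n → M ℕ.≤ n → Near N (s n) x

    Cauchy : (ℕ → ^.Carrier) → Set
    Cauchy s = ∀ N → ∃[ M ] ∀ m n → M ℕ.≤ m → M ℕ.≤ n → Near N (s m) (s n)

    field
      val-cong : ∀ {x y} x#0 y#0 → x ^.≈ y → val x x#0 ≡ val y y#0
      val-*    : ∀ {x y} x#0 y#0 xy#0 →
                 val (x ^.* y) xy#0 ≡ val x x#0 ℤ.+ val y y#0
      val-+    : ∀ {x y} n → Val≥ n x → Val≥ n y → Val≥ n (x ^.+ y)
      extends  : ∀ {a} n → a ∈ 𝒪 → a ∈ idealPower 𝔭 n ⇔ Val≥ (+ n) (ι a)
      dense    : ∀ x n → ∃[ a ] Near n x (ι a)
      complete : ∀ s → Cauchy s → ∃[ x ] Limit s x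

    -- The maximal ideal of the valuation ring.
    𝔪 : Pred ^.Carrier 0ℓ
    𝔪 = Val≥ (+ 1)

------------------------------------------------------------------------
-- p-adic integers

-- Sequences of natural numbers that are coherent modulo the powers of p;
-- the n-th term is a representative of the p-adic integer modulo p ^ n.
record ℤₚ (p : ℕ) : Set where
  field
    approx   : ℕ → ℕ
    coherent : ∀ n → p ℕ.^ n ∣ ℕ.∣ approx (suc n) - approx n ∣

  IsZero : Set
  IsZero = ∀ n → p ℕ.^ n ∣ approx n

------------------------------------------------------------------------
-- Global and local units

module Units (K : NumberField) (p : ℕ) (S : PrimesAbove K p)
             (C : ∀ i → Completion K (PrimesAbove.𝔭 S i)) where
  open NumberField K
  open PrimesAbove S
  private module C i = Completion (C i)

  E : Pred Carrier 0ℓ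
  E ε = ε ∈ 𝒪 × (∃[ η ] η ∈ 𝒪 × ε * η ≈ 1#) × ε - 1# ∈ ∏𝔭

  E^ : ℕ → Pred Carrier 0ℓ
  E^ m ε = ∃[ η ] η ∈ E × ε ≈ η ^ m

  μ : Pred Carrier 0ℓ
  μ ζ = ∃[ k ] ζ ^ (p ℕ.^ k) ≈ 1#

  Local : Set
  Local = ∀ i → C.^.Carrier i

  diag : Carrier → Local
  diag x i = C.ι i x

  infix  4 _≈ᴸ_
  infixr 8 _^ᴸ_

  _≈ᴸ_ : Local → Local → Set
  u ≈ᴸ v = ∀ i → C.^._≈_ i (u i) (v i)

  _^ᴸ_ : Local → ℕ → Local
  (u ^ᴸ m) i = C.^._^_ i (u i) m

  1ᴸ : Local
  1ᴸ i = C.^.1# i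

  productᴸ : ∀ {r} → Vector Local r → Local
  productᴸ u i = C.^.product i (λ j → u j i)

  U : Pred Local 0ℓ
  U u = ∀ i → C.^._#_ i (u i) (C.^.0# i) ×
              (∃[ x ] x ∈ C.𝔪 i × C.^._≈_ i (u i) (C.^._+_ i (C.^.1# i) x))

  U^ : ℕ → Pred Local 0ℓ
  U^ m u = ∃[ v ] v ∈ U × u ≈ᴸ v ^ᴸ m

  Limitᴸ : (ℕ → Local) → Local → Set
  Limitᴸ s u = ∀ i → C.Limit i (λ n → s n i) (u i)

  -- For x j in U and p-adic integers a j, the product of the x j ^ a j is
  -- the limit of the products of the x j ^ approx (a j) n.
  Relationₚ : ∀ {r} → Vector Local r → Vector (ℤₚ p) r → Set
  Relationₚ x a =
    Limitᴸ (λ n → productᴸ (λ j → x j ^ᴸ ℤₚ.approx (a j) n)) 1ᴸ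

  W : Pred Local 0ℓ
  W u = u ∈ U × ∃[ a ] ¬ ℤₚ.IsZero {p} a ×
        Limitᴸ (λ n → u ^ᴸ ℤₚ.approx a n) 1ᴸ

  W^ : ℕ → Pred Local 0ℓ
  W^ m u = ∃[ w ] w ∈ W × u ≈ᴸ w ^ᴸ m

  diag-μ : Pred Local 0ℓ
  diag-μ u = ∃[ ζ ] ζ ∈ μ × u ≈ᴸ diag ζ

  E-closure : Pred Local 0ℓ
  E-closure u = u ∈ U × ∀ N → ∃[ ε ] ε ∈ E × ∀ i → C.Near i N (u i) (diag ε i)

  ----------------------------------------------------------------------
  -- Ranks, as the maximal number of independent elements

  -- An integer relation is written with its positive exponents m on one
  -- side and its negative exponents n on the other.
  ℤ-Independent : ∀ {r} → Vector Carrier r → Set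
  ℤ-Independent ε = ∀ m n →
    product (λ j → ε j ^ m j) ≈ product (λ j → ε j ^ n j) → m ≗ n

  ℤₚ-Independent : ∀ {r} → Vector Local r → Set
  ℤₚ-Independent x = ∀ a → Relationₚ x a → ∀ j → ℤₚ.IsZero (a j)

  ℤ-RankE : ℕ → Set
  ℤ-RankE r =
    (Σ (Vector Carrier r) λ ε → (∀ j → ε j ∈ E) × ℤ-Independent ε) ×
    (∀ (ε : Vector Carrier (suc r)) → (∀ j → ε j ∈ E) → ¬ ℤ-Independent ε)

  ℤₚ-RankE-closure : ℕ → Set
  ℤₚ-RankE-closure r =
    (Σ (Vector Local r) λ x → (∀ j → x j ∈ E-closure) × ℤₚ-Independent x) ×
    (∀ (x : Vector Local (suc r)) → (∀ j → x j ∈ E-closure) →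
       ¬ ℤₚ-Independent x)

  Leopoldt : Set
  Leopoldt = ∃[ r ] ℤₚ-RankE-closure r × ℤ-RankE r

  ----------------------------------------------------------------------
  -- The Kummer–Leopoldt constant and the exponent of W / μ

  KummerLeopoldtBound : ℕ → Set
  KummerLeopoldtBound c = ∃[ N ] ∀ n → N ℕ.≤ n → ∀ ε → ε ∈ E →
    diag ε ∈ U^ (p ℕ.^ (n ℕ.+ c)) → ε ∈ E^ (p ℕ.^ n)

  IsKummerLeopoldtConstant : ℕ → Set
  IsKummerLeopoldtConstant κ =
    KummerLeopoldtBound κ × (∀ c → KummerLeopoldtBound c → κ ℕ.≤ c)

  KillsW/μ : ℕ → Set
  KillsW/μ e = ∀ w → w ∈ W → w ^ᴸ e ∈ diag-μ

  IsExponentW/μ : ℕ → Set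
  IsExponentW/μ e =
    KillsW/μ e × (∀ d → ℕ.NonZero d → KillsW/μ d → e ℕ.≤ d)

{-# OPTIONS --safe #-}

-- If ε = u ^ p^(n+κ) locally, then for large N the unit ε ^ p^N falls under
-- the definition of κ, so ε ^ p^N = η ^ p^(n+N) and ζ = ε / η ^ p^n is a root
-- of unity; locally it is the p^n-th power of w = u ^ p^κ / η, which is then
-- torsion.  If W = μ, then w is itself a root of unity ξ and
-- ε = (ξ η) ^ p^n.  That ξ is congruent to 1 modulo the product of the primes
-- above p, and not just modulo each of them, uses that these are comaximal.

module Submission where

open import Defs
open import Algebra.Bundles using (CommutativeRing)
import Algebra.Apartness.Properties.HeytingCommutativeRing as HeytingProperties
import Algebra.Morphism.Construct.Composition as Composition
open import Algebra.Morphism.Structures using (module RingMorphisms)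
import Algebra.Properties.CommutativeSemiring.Exp as Exp
import Algebra.Properties.Semiring.Sum as Sum
import Algebra.Solver.Ring as Solver
open import Algebra.Solver.Ring.AlmostCommutativeRing
  using (fromCommutativeRing; _-Raw-AlmostCommutative⟶_)
open import Data.Fin.Base using (Fin; zero; suc; toℕ; fromℕ<; combine; remQuot)
open import Data.Fin.Properties
  using (suc-injective; toℕ<n; toℕ-fromℕ<; remQuot-combine)
open import Data.Integer.Base as ℤ using (ℤ; +_; -[1+_]; 0ℤ; 1ℤ; +≤+)
open import Data.Integer.Divisibility.Signed using (divides; ∣ᵤ⇒∣)
import Data.Integer.Properties as ℤ
open import Data.Maybe.Base using (Maybe; just; nothing)
open import Data.Nat.Base as ℕ using (ℕ; zero; suc; s≤s; z≤n)
open import Data.Nat.Coprimality using (Coprime; coprime-Bézout)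
open import Data.Nat.Divisibility using (_∣_; _∣?_; _∣0; >⇒∤)
open import Data.Nat.GCD using (module Bézout)
open import Data.Nat.Primality
  using (Prime; prime⇒irreducible; prime⇒nonTrivial; prime⇒nonZero)
import Data.Nat.Properties as ℕ
open import Data.Product.Base using (Σ; ∃-syntax; _×_; _,_; proj₁; proj₂)
open import Data.Rational.Base as ℚ using ()
import Data.Rational.Properties as ℚ
import Data.Rational.Unnormalised.Base as ℚᵘ
import Data.Rational.Unnormalised.Properties as ℚᵘ
open import Data.Sum.Base using (_⊎_; inj₁; inj₂)
open import Data.Vec.Functional using (Vector; foldr; _∷_)
open import Function.Base using (_∘_)
open import Function.Bundles using (module Equivalence)
open import Level using (0ℓ)
open import Relation.Binary.PropositionalEquality.Core as ≡ using (_≡_; _≢_)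
import Relation.Binary.Reasoning.Setoid as SetoidReasoning
open import Relation.Nullary.Decidable using (yes; no)
open import Relation.Nullary.Negation.Core using (¬_; contradiction)
open import Relation.Unary using (Pred; _∈_; _∉_; _⊆_)

-- `𝒪` is given element by element, through monic equations. That `E` is closed under products, or
-- that `ξ - 1` is integral, therefore rests on the fact that sums and products of integral elements
-- are integral, which has to be proved for the elements themselves. Fields are Heyting fields:
-- neither equality with 0 nor membership in an ideal can be decided, so linear algebra has to avoid
-- division, and comaximality of two primes is not derived from their maximality. What can be
-- decided is divisibility of an integer by `p`. This is why comaximality is read off the integer
-- coefficients of a monic equation, for an element that lies in one prime and not in the other.

module Integrality
  (R : CommutativeRing 0ℓ 0ℓ) (φ : ℤ → CommutativeRing.Carrier R)
  (φ-homo : RingMorphisms.IsRingHomomorphism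
              ℤ.+-*-rawRing (CommutativeRing.rawRing R) φ)
  where

  open CommutativeRing R hiding (zero)
  open RingMorphisms.IsRingHomomorphism φ-homo public
    using (+-homo; *-homo; -‿homo; 0#-homo; 1#-homo)
  open Exp commutativeSemiring
  open Sum semiring using (sum; sum-cong-≋; *-distribˡ-sum; ∑-distrib-+)
  open SetoidReasoning setoid

  private
    φ-≟ : ∀ a b → Maybe (φ a ≈ φ b)
    φ-≟ a b with a ℤ.≟ b
    ... | yes a≡b = just (reflexive (≡.cong φ a≡b))
    ... | no _    = nothing

    φ-morphism : ℤ.+-*-rawRing -Raw-AlmostCommutative⟶ fromCommutativeRing R
    φ-morphism = record
      { ⟦_⟧ = φ ; +-homo = +-homo ; *-homo = *-homo
      ; -‿homo = -‿homo ; 0-homo = 0#-homo ; 1-homo = 1#-homo }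

  open Solver ℤ.+-*-rawRing (fromCommutativeRing R) φ-morphism φ-≟ public
    using (solve; _:=_; _:+_; _:*_; _:-_; :-_; con)

  -- y ∈ Poly x d l means y = c₀ + c₁ x + … + c_{d-1} x^{d-1} + l x^d for
  -- some integers cᵢ.
  Poly : Carrier → ℕ → ℤ → Pred Carrier 0ℓ
  Poly x zero    l y = y ≈ φ l
  Poly x (suc d) l y = ∃[ c ] ∃[ z ] z ∈ Poly x d l × y ≈ φ c + x * z

  -- The Horner form of the condition in `𝒪`. Recursion on the degree then peels off constant
  -- coefficients, where the sum in `𝒪` would have to be reindexed; `toPoly` and `fromPoly`
  -- translate.
  Integral : Pred Carrier 0ℓ
  Integral x = ∃[ n ] 0# ∈ Poly x n 1ℤ

  -- Arithmetic of integer polynomials in one element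

  module _ {x : Carrier} where

    Poly-resp : ∀ d {l y z} → y ≈ z → y ∈ Poly x d l → z ∈ Poly x d l
    Poly-resp zero    y≈z y≈l             = trans (sym y≈z) y≈l
    Poly-resp (suc d) y≈z (c , w , w∈ , e) = c , w , w∈ , trans (sym y≈z) e

    Poly-+ : ∀ d {k l y z} → y ∈ Poly x d k → z ∈ Poly x d l →
             y + z ∈ Poly x d (k ℤ.+ l)
    Poly-+ zero    y≈ z≈ = trans (+-cong y≈ z≈) (sym (+-homo _ _))
    Poly-+ (suc d) (b , v , v∈ , y≈) (c , w , w∈ , z≈) =
      b ℤ.+ c , v + w , Poly-+ d v∈ w∈ , (begin
        _ ≈⟨ +-cong y≈ z≈ ⟩
        (φ b + x * v) + (φ c + x * w)
          ≈⟨ solve 5 (λ b c x v w →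
               (b :+ x :* v) :+ (c :+ x :* w) := (b :+ c) :+ x :* (v :+ w))
               refl _ _ _ _ _ ⟩
        (φ b + φ c) + x * (v + w) ≈⟨ +-congʳ (+-homo b c) ⟨
        φ (b ℤ.+ c) + x * (v + w) ∎)

    Poly-scale : ∀ d c {l y} → y ∈ Poly x d l → φ c * y ∈ Poly x d (c ℤ.* l)
    Poly-scale zero    c y≈ = trans (*-congˡ y≈) (sym (*-homo _ _))
    Poly-scale (suc d) c (b , v , v∈ , y≈) =
      c ℤ.* b , φ c * v , Poly-scale d c v∈ , (begin
        _ ≈⟨ *-congˡ y≈ ⟩
        φ c * (φ b + x * v)
          ≈⟨ solve 4 (λ c b x v →
               c :* (b :+ x :* v) := c :* b :+ x :* (c :* v)) refl _ _ _ _ ⟩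
        φ c * φ b + x * (φ c * v) ≈⟨ +-congʳ (*-homo c b) ⟨
        φ (c ℤ.* b) + x * (φ c * v) ∎)

    -- Pads with a zero top coefficient, since `Poly-+` adds only expressions of equal length.
    Poly-raise : ∀ d {l y} → y ∈ Poly x d l → y ∈ Poly x (suc d) 0ℤ
    Poly-raise zero {l} y≈ = l , 0# , sym 0#-homo ,
      trans y≈ (sym (trans (+-congˡ (zeroʳ x)) (+-identityʳ _)))
    Poly-raise (suc d) (c , z , z∈ , e) = c , z , Poly-raise d z∈ , e

    Poly-shift : ∀ d {l y} → y ∈ Poly x d l → x * y ∈ Poly x (suc d) l
    Poly-shift d {y = y} y∈ =
      0ℤ , y , y∈ , sym (trans (+-congʳ 0#-homo) (+-identityˡ _))

    Poly-* : ∀ d e {k l y z} → y ∈ Poly x d k → z ∈ Poly x e l →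
             y * z ∈ Poly x (d ℕ.+ e) (k ℤ.* l)
    Poly-* zero e {k} y≈ z∈ =
      Poly-resp e (*-congʳ (sym y≈)) (Poly-scale e k z∈)
    Poly-* (suc d) e {k} {l} {y} {z} (c , v , v∈ , y≈) z∈ =
      -- The summand `φ c * z` is padded to full length and has leading coefficient 0; the sum
      -- therefore has `0ℤ + k l`.
      ≡.subst (λ m → y * z ∈ Poly x (suc d ℕ.+ e) m) (ℤ.+-identityˡ (k ℤ.* l))
        (Poly-resp (suc d ℕ.+ e)
          (begin
            φ c * z + x * (v * z)
              ≈⟨ solve 4 (λ c x v z →
                   c :* z :+ x :* (v :* z) := (c :+ x :* v) :* z)
                   refl _ _ _ _ ⟩
            (φ c + x * v) * z ≈⟨ *-congʳ y≈ ⟨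
            y * z ∎)
          (Poly-+ (suc d ℕ.+ e)
            (low d (Poly-scale e c z∈))
            (Poly-shift (d ℕ.+ e) (Poly-* d e v∈ z∈))))
      where
      low : ∀ d {l y} → y ∈ Poly x e l → y ∈ Poly x (suc d ℕ.+ e) 0ℤ
      low zero    = Poly-raise e
      low (suc d) = Poly-raise (suc d ℕ.+ e) ∘ low d

  sum-shift : ∀ x {n} (c : Vector ℤ n) →
              sum (λ i → φ (c i) * x ^ suc (toℕ i)) ≈
              x * sum (λ i → φ (c i) * x ^ toℕ i)
  sum-shift x c = sym (trans (*-distribˡ-sum x (λ i → φ (c i) * x ^ toℕ i))
    (sum-cong-≋ {x = λ i → x * (φ (c i) * x ^ toℕ i)}
      (λ i → solve 3 (λ x c y → x :* (c :* y) := c :* (x :* y)) refl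
        x (φ (c i)) (x ^ toℕ i))))

  toPoly : ∀ x n l (c : Vector ℤ n) →
           φ l * x ^ n + sum (λ i → φ (c i) * x ^ toℕ i) ∈ Poly x n l
  toPoly x zero l c =
    trans (+-identityʳ _) (*-identityʳ _)
  toPoly x (suc n) l c = c zero , _ , toPoly x n l (c ∘ suc) , (begin
    φ l * (x * x ^ n) + (φ (c zero) * 1# + tail)
      ≈⟨ +-congˡ (+-cong (*-identityʳ _) (sum-shift x (c ∘ suc))) ⟩
    φ l * (x * x ^ n) + (φ (c zero) + x * tail′)
      ≈⟨ solve 5 (λ l x y c t →
           l :* (x :* y) :+ (c :+ x :* t) := c :+ x :* (l :* y :+ t))
           refl _ _ _ _ _ ⟩
    φ (c zero) + x * (φ l * x ^ n + tail′) ∎)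
    where
    tail  = sum (λ i → φ (c (suc i)) * (x * x ^ toℕ i))
    tail′ = sum (λ i → φ (c (suc i)) * x ^ toℕ i)

  fromPoly : ∀ x n {l y} → y ∈ Poly x n l →
             Σ (Vector ℤ n) λ c →
             y ≈ φ l * x ^ n + sum (λ i → φ (c i) * x ^ toℕ i)
  fromPoly x zero y≈ =
    (λ ()) , trans y≈ (sym (trans (+-identityʳ _) (*-identityʳ _)))
  fromPoly x (suc n) {l} {y} (c , z , z∈ , y≈) with fromPoly x n z∈
  ... | cs , z≈ = (λ { zero → c ; (suc i) → cs i }) , (begin
    y ≈⟨ y≈ ⟩
    φ c + x * z ≈⟨ +-congˡ (*-congˡ z≈) ⟩
    φ c + x * (φ l * x ^ n + tail′)
      ≈⟨ solve 5 (λ l x y c t →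
           l :* (x :* y) :+ (c :+ x :* t) := c :+ x :* (l :* y :+ t))
           refl _ _ _ _ _ ⟨
    φ l * (x * x ^ n) + (φ c + x * tail′)
      ≈⟨ +-congˡ (+-cong (*-identityʳ _) (sum-shift x cs)) ⟨
    φ l * (x * x ^ n) + (φ c * 1# + tail) ∎)
    where
    tail  = sum (λ i → φ (cs i) * (x * x ^ toℕ i))
    tail′ = sum (λ i → φ (cs i) * x ^ toℕ i)

  -- Sums and elimination in linear systems

  δ : ∀ {n} → Fin n → Fin n → ℤ
  δ zero    zero    = 1ℤ
  δ zero    (suc j) = 0ℤ
  δ (suc i) zero    = 0ℤ
  δ (suc i) (suc j) = δ i j

  -- Opaque, so that unification sees through an equation between two sums.
  opaque
    ∑ : ∀ {n} → Vector Carrier n → Carrier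
    ∑ = sum

    ∑-[] : (f : Vector Carrier 0) → ∑ f ≈ 0#
    ∑-[] f = refl

    ∑-∷ : ∀ {n} (f : Vector Carrier (suc n)) → ∑ f ≈ f zero + ∑ (f ∘ suc)
    ∑-∷ f = refl

    ∑-cong : ∀ {n} {f g : Vector Carrier n} → (∀ i → f i ≈ g i) → ∑ f ≈ ∑ g
    ∑-cong = sum-cong-≋

    ∑-+ : ∀ {n} (f g : Vector Carrier n) → ∑ (λ i → f i + g i) ≈ ∑ f + ∑ g
    ∑-+ = ∑-distrib-+

    *-distribˡ-∑ : ∀ {n} a (f : Vector Carrier n) →
                   a * ∑ f ≈ ∑ (λ i → a * f i)
    *-distribˡ-∑ = *-distribˡ-sum

  ∑-zero : ∀ {n} (f : Vector Carrier n) → (∀ i → f i ≈ 0#) → ∑ f ≈ 0#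
  ∑-zero {zero}  f f≈0 = ∑-[] f
  ∑-zero {suc n} f f≈0 = trans (∑-∷ f)
    (trans (+-cong (f≈0 zero) (∑-zero (f ∘ suc) (f≈0 ∘ suc))) (+-identityˡ 0#))

  ∑-δ : ∀ {n} (i : Fin n) (v : Vector Carrier n) →
        ∑ (λ j → φ (δ i j) * v j) ≈ v i
  ∑-δ zero v = trans (∑-∷ _) (trans
    (+-cong (trans (*-congʳ 1#-homo) (*-identityˡ _))
      (∑-zero _ (λ j → trans (*-congʳ 0#-homo) (zeroˡ _))))
    (+-identityʳ _))
  ∑-δ (suc i) v = trans (∑-∷ _) (trans
    (+-cong (trans (*-congʳ 0#-homo) (zeroˡ _)) (∑-δ i (v ∘ suc)))
    (+-identityˡ _))

  ∑-linear : ∀ {n} a b (f g : Vector Carrier n) →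
             ∑ (λ i → a * f i + b * g i) ≈ a * ∑ f + b * ∑ g
  ∑-linear a b f g = trans (∑-+ _ _)
    (+-cong (sym (*-distribˡ-∑ a f)) (sym (*-distribˡ-∑ b g)))

  -- A substitute for the determinant: a linear system with monic diagonal
  -- entries of degree d and off-diagonal entries of lower degree keeps this
  -- shape, with 2d for d, when its first unknown is eliminated.
  eliminate : ∀ x N d (M : Fin N → Fin N → Carrier) (v : Vector Carrier N) →
              (∀ i j → M i j ∈ Poly x d (δ i j)) →
              (∀ i → ∑ (λ j → M i j * v j) ≈ 0#) →
              ∃[ e ] ∃[ f ] f ∈ Poly x e 1ℤ × (∀ k → f * v k ≈ 0#)
  eliminate x zero    d M v M∈ Mv≈0 = 0 , φ 1ℤ , refl , λ ()
  eliminate x (suc N) d M v M∈ Mv≈0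
    with eliminate x N (d ℕ.+ d) M′ (v ∘ suc) M′∈ M′v≈0
    where
    M′ : Fin N → Fin N → Carrier
    -- Cross-multiplication of two rows: the pivot `M zero zero` is monic but need not be
    -- invertible.
    M′ i j = M zero zero * M (suc i) (suc j)
           + φ -[1+ 0 ] * (M (suc i) zero * M zero (suc j))

    M′∈ : ∀ i j → M′ i j ∈ Poly x (d ℕ.+ d) (δ i j)
    -- The subtracted product has two off-diagonal factors, so it contributes 0 to the leading
    -- coefficient.
    M′∈ i j = ≡.subst (λ l → M′ i j ∈ Poly x (d ℕ.+ d) l)
      (≡.trans (ℤ.+-identityʳ _) (ℤ.*-identityˡ (δ i j)))
      (Poly-+ (d ℕ.+ d)
        (Poly-* d d (M∈ zero zero) (M∈ (suc i) (suc j)))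
        (Poly-scale (d ℕ.+ d) -[1+ 0 ]
          (Poly-* d d (M∈ (suc i) zero) (M∈ zero (suc j)))))

    row : ∀ i → M i zero * v zero + ∑ (λ j → M i (suc j) * v (suc j)) ≈ 0#
    row i = trans (sym (∑-∷ _)) (Mv≈0 i)

    M′v≈0 : ∀ i → ∑ (λ j → M′ i j * v (suc j)) ≈ 0#
    M′v≈0 i = begin
      ∑ (λ j → M′ i j * v (suc j))
        ≈⟨ ∑-cong (λ j → solve 5 (λ a b c d v →
             (a :* b :+ con -[1+ 0 ] :* (c :* d)) :* v :=
             a :* (b :* v) :+ (:- c) :* (d :* v)) refl _ _ _ _ _) ⟩
      ∑ (λ j → M zero zero * (M (suc i) (suc j) * v (suc j))
               + (- M (suc i) zero) * (M zero (suc j) * v (suc j)))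
        ≈⟨ ∑-linear _ _ _ _ ⟩
      M zero zero * Sᵢ + (- M (suc i) zero) * S₀
        ≈⟨ solve 5 (λ a c v s t →
             a :* s :+ (:- c) :* t :=
             a :* (c :* v :+ s) :+ (:- c) :* (a :* v :+ t))
             refl _ _ (v zero) _ _ ⟩
      M zero zero * (M (suc i) zero * v zero + Sᵢ)
        + (- M (suc i) zero) * (M zero zero * v zero + S₀)
        ≈⟨ +-cong (*-congˡ (row (suc i))) (*-congˡ (row zero)) ⟩
      M zero zero * 0# + (- M (suc i) zero) * 0#
        ≈⟨ +-cong (zeroʳ _) (zeroʳ _) ⟩
      0# + 0# ≈⟨ +-identityˡ 0# ⟩
      0# ∎
      where
      S₀ = ∑ (λ j → M zero (suc j) * v (suc j))
      Sᵢ = ∑ (λ j → M (suc i) (suc j) * v (suc j))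
  -- `f` kills all unknowns but the first. By row 0, `f` times the pivot then kills the first one as
  -- well.
  ... | e , f , f∈ , fv≈0 = e ℕ.+ d , f * M zero zero ,
    Poly-* e d f∈ (M∈ zero zero) , kills
    where
    S₀ = ∑ (λ j → M zero (suc j) * v (suc j))

    row : M zero zero * v zero + S₀ ≈ 0#
    row = trans (sym (∑-∷ _)) (Mv≈0 zero)

    f*S₀≈0 : f * S₀ ≈ 0#
    f*S₀≈0 = trans (*-distribˡ-∑ f _) (∑-zero _ (λ j → begin
      f * (M zero (suc j) * v (suc j))
        ≈⟨ solve 3 (λ f m v → f :* (m :* v) := m :* (f :* v)) refl _ _ _ ⟩
      M zero (suc j) * (f * v (suc j)) ≈⟨ *-congˡ (fv≈0 j) ⟩
      M zero (suc j) * 0#              ≈⟨ zeroʳ _ ⟩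
      0# ∎))

    kills : ∀ k → f * M zero zero * v k ≈ 0#
    kills zero = begin
      f * M zero zero * v zero
        ≈⟨ solve 4 (λ f m v s →
             f :* m :* v := f :* (m :* v :+ s) :- f :* s) refl _ _ _ S₀ ⟩
      f * (M zero zero * v zero + S₀) - f * S₀
        ≈⟨ +-cong (trans (*-congˡ row) (zeroʳ f)) (-‿cong f*S₀≈0) ⟩
      0# - 0# ≈⟨ -‿inverseʳ 0# ⟩
      0# ∎
    kills (suc k) = begin
      f * M zero zero * v (suc k)
        ≈⟨ solve 3 (λ f m v → f :* m :* v := m :* (f :* v)) refl _ _ _ ⟩
      M zero zero * (f * v (suc k)) ≈⟨ *-congˡ (fv≈0 k) ⟩
      M zero zero * 0#              ≈⟨ zeroʳ _ ⟩
      0# ∎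

  -- Finitely generated modules and integral elements

  record IsSubmodule (P : Pred Carrier 0ℓ) : Set where
    field
      resp  : ∀ {y z} → y ≈ z → y ∈ P → z ∈ P
      +-mem : ∀ {y z} → y ∈ P → z ∈ P → y + z ∈ P
      scale : ∀ c {y} → y ∈ P → φ c * y ∈ P
      0-mem : 0# ∈ P

    ∑-mem : ∀ {n} (f : Vector Carrier n) → (∀ i → f i ∈ P) → ∑ f ∈ P
    ∑-mem {zero}  f f∈ = resp (sym (∑-[] f)) 0-mem
    ∑-mem {suc n} f f∈ = resp (sym (∑-∷ f))
      (+-mem (f∈ zero) (∑-mem (f ∘ suc) (f∈ ∘ suc)))

    -- If w = c₀ + c₁ y + … + l y^d, then l y^d t is w t minus the terms
    -- cᵢ yⁱ t.
    leading-mem : ∀ y t d {l w} → w ∈ Poly y d l → w * t ∈ P →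
                  (∀ i → i ℕ.< d → y ^ i * t ∈ P) → φ l * (y ^ d * t) ∈ P
    leading-mem y t zero w≈ wt∈ lower =
      resp (*-cong w≈ (sym (*-identityˡ t))) wt∈
    leading-mem y t (suc d) {l} {w} (c , z , z∈ , w≈) wt∈ lower =
      resp (*-congˡ (solve 3 (λ a y t → a :* (y :* t) := y :* a :* t) refl _ _ _))
        (leading-mem y (y * t) d z∈
          (resp
            (begin
              w * t + φ -[1+ 0 ] * (φ c * (1# * t))
                ≈⟨ +-cong (*-congʳ w≈) (*-congˡ (*-congˡ (*-identityˡ t))) ⟩
              (φ c + y * z) * t + φ -[1+ 0 ] * (φ c * t)
                ≈⟨ solve 4 (λ c y z t →
                     (c :+ y :* z) :* t :+ con -[1+ 0 ] :* (c :* t) :=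
                     z :* (y :* t)) refl _ _ _ _ ⟩
              z * (y * t) ∎)
            (+-mem wt∈ (scale -[1+ 0 ] (scale c (lower 0 (s≤s z≤n))))))
          (λ i i<d → resp
            (solve 3 (λ a y t → y :* a :* t := a :* (y :* t)) refl _ _ _)
            (lower (suc i) (s≤s i<d))))

  Span : ∀ {N} → Vector Carrier N → Pred Carrier 0ℓ
  Span {N} v y = Σ (Vector ℤ N) λ c → y ≈ ∑ (λ i → φ (c i) * v i)

  module _ {N : ℕ} (v : Vector Carrier N) where

    Span-isSubmodule : IsSubmodule (Span v)
    Span-isSubmodule = record
      { resp  = λ { y≈z (c , y≈) → c , trans (sym y≈z) y≈ }
      ; +-mem = λ { (b , y≈) (c , z≈) → (λ i → b i ℤ.+ c i) ,
          trans (+-cong y≈ z≈) (trans (sym (∑-+ _ _))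
            (∑-cong (λ i → trans (sym (distribʳ _ _ _))
              (*-congʳ (sym (+-homo _ _)))))) }
      ; scale = λ { a (c , y≈) → (λ i → a ℤ.* c i) ,
          trans (*-congˡ y≈) (trans (*-distribˡ-∑ _ _)
            (∑-cong (λ i → trans (sym (*-assoc _ _ _))
              (*-congʳ (sym (*-homo _ _)))))) }
      ; 0-mem = (λ _ → 0ℤ) ,
          sym (∑-zero _ (λ i → trans (*-congʳ 0#-homo) (zeroˡ _)))
      }

    open IsSubmodule Span-isSubmodule

    generator∈Span : ∀ i → v i ∈ Span v
    generator∈Span i = δ i , sym (∑-δ i v)

    Stable : Pred Carrier 0ℓ
    Stable x = ∀ i → x * v i ∈ Span v

    stable-Span : ∀ {x y} → x ∈ Stable → y ∈ Span v → x * y ∈ Span v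
    stable-Span {x} {y} x∈ (c , y≈) = resp
      (begin
        ∑ (λ i → φ (c i) * (x * v i))
          ≈⟨ ∑-cong (λ i → solve 3 (λ c x v →
               c :* (x :* v) := x :* (c :* v)) refl _ _ _) ⟩
        ∑ (λ i → x * (φ (c i) * v i)) ≈⟨ *-distribˡ-∑ x _ ⟨
        x * ∑ (λ i → φ (c i) * v i)   ≈⟨ *-congˡ y≈ ⟨
        x * y ∎)
      (∑-mem _ (λ i → scale (c i) (x∈ i)))

    stable-+ : ∀ {x y} → x ∈ Stable → y ∈ Stable → x + y ∈ Stable
    stable-+ x∈ y∈ i = resp (sym (distribʳ _ _ _)) (+-mem (x∈ i) (y∈ i))

    stable-* : ∀ {x y} → x ∈ Stable → y ∈ Stable → x * y ∈ Stable
    stable-* x∈ y∈ i = resp (sym (*-assoc _ _ _)) (stable-Span x∈ (y∈ i))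

    -- The Cayley-Hamilton argument. If `c` is the integer matrix of multiplication by `x` on the
    -- generators, then `x I - c` annihilates the vector `v` and has entries of degree 1 with
    -- leading coefficients `δ i j`. Elimination gives a monic expression `f` in `x` that kills
    -- every generator, hence kills 1, so `f` itself is 0.
    stable⇒integral : 1# ∈ Span v → ∀ {x} → x ∈ Stable → Integral x
    stable⇒integral (b , 1≈) {x} x∈ =
      let e , f , f∈ , fv≈0 = eliminate x N 1 M v
            (λ i j → _ , _ , refl , refl) Mv≈0
      in e , Poly-resp e
        (begin
          f                               ≈⟨ *-identityʳ f ⟨
          f * 1#                          ≈⟨ *-congˡ 1≈ ⟩
          f * ∑ (λ i → φ (b i) * v i)   ≈⟨ *-distribˡ-∑ f _ ⟩
          ∑ (λ i → f * (φ (b i) * v i)) ≈⟨ ∑-zero _ (λ i → trans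
             (solve 3 (λ f b v → f :* (b :* v) := b :* (f :* v)) refl _ _ _)
             (trans (*-congˡ (fv≈0 i)) (zeroʳ _))) ⟩
          0# ∎)
        f∈
      where
      M : Fin N → Fin N → Carrier
      M i j = φ (ℤ.- proj₁ (x∈ i) j) + x * φ (δ i j)

      Mv≈0 : ∀ i → ∑ (λ j → M i j * v j) ≈ 0#
      Mv≈0 i = begin
        ∑ (λ j → M i j * v j)
          ≈⟨ ∑-cong (λ j → trans
               (*-congʳ (+-congʳ (-‿homo (c j))))
               (solve 4 (λ c x d v →
                 (:- c :+ x :* d) :* v :=
                 con -[1+ 0 ] :* (c :* v) :+ x :* (d :* v))
                 refl _ _ _ _)) ⟩
        ∑ (λ j → φ -[1+ 0 ] * (φ (c j) * v j) + x * (φ (δ i j) * v j))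
          ≈⟨ ∑-linear _ _ _ _ ⟩
        φ -[1+ 0 ] * ∑ (λ j → φ (c j) * v j) + x * ∑ (λ j → φ (δ i j) * v j)
          ≈⟨ +-cong (*-congˡ (sym (proj₂ (x∈ i)))) (*-congˡ (∑-δ i v)) ⟩
        φ -[1+ 0 ] * (x * v i) + x * v i
          ≈⟨ solve 1 (λ y → con -[1+ 0 ] :* y :+ y := con 0ℤ) refl _ ⟩
        φ 0ℤ ≈⟨ 0#-homo ⟩
        0# ∎
        where c = proj₁ (x∈ i)

  φ-integral : ∀ c → Integral (φ c)
  φ-integral c = 1 , ℤ.- c , φ 1ℤ , refl , sym (begin
    φ (ℤ.- c) + φ c * φ 1ℤ
      ≈⟨ +-cong (-‿homo c) (trans (*-congˡ 1#-homo) (*-identityʳ _)) ⟩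
    - φ c + φ c ≈⟨ -‿inverseˡ _ ⟩
    0# ∎)

  integral-resp : ∀ {x y} → x ≈ y → Integral x → Integral y
  integral-resp {x} {y} x≈y (n , 0∈) = n , go n 0∈
    where
    go : ∀ d {l z} → z ∈ Poly x d l → z ∈ Poly y d l
    go zero    z≈ = z≈
    go (suc d) (c , w , w∈ , z≈) =
      c , w , go d w∈ , trans z≈ (+-congˡ (*-congʳ x≈y))

  -- The module spanned by these monomials is all of ℤ[x, y], because the two monic equations
  -- rewrite `x ^ m` and `y ^ n` in lower powers. It is therefore stable under both elements.
  module Monomials {x y : Carrier} (m n : ℕ)
    (0∈₁ : 0# ∈ Poly x m 1ℤ) (0∈₂ : 0# ∈ Poly y n 1ℤ) where

    term : Fin m × Fin n → Carrier
    term (i , j) = x ^ toℕ i * y ^ toℕ j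

    monomials : Vector Carrier (m ℕ.* n)
    monomials = term ∘ remQuot {m} n

    open IsSubmodule (Span-isSubmodule monomials)

    monomial : ∀ i j → i ℕ.< m → j ℕ.< n → x ^ i * y ^ j ∈ Span monomials
    monomial i j i<m j<n = resp (reflexive eq)
      (generator∈Span monomials (combine (fromℕ< i<m) (fromℕ< j<n)))
      where
      eq : monomials (combine (fromℕ< i<m) (fromℕ< j<n)) ≡ x ^ i * y ^ j
      eq = ≡.trans
        (≡.cong term (remQuot-combine (fromℕ< i<m) (fromℕ< j<n)))
        (≡.cong₂ (λ i j → x ^ i * y ^ j) (toℕ-fromℕ< i<m) (toℕ-fromℕ< j<n))

    zero-mul : ∀ t → 0# * t ∈ Span monomials
    zero-mul t = resp (sym (zeroˡ t)) 0-mem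

    -- Only the top exponent, `suc i = k`, leaves the given range. There the monic equation times
    -- `t` has left side `0# * t`, and `leading-mem` isolates `u ^ k * t`.
    next : ∀ u k t → 0# ∈ Poly u k 1ℤ →
           (∀ i → i ℕ.< k → u ^ i * t ∈ Span monomials) →
           ∀ i → i ℕ.< k → u ^ suc i * t ∈ Span monomials
    next u k t 0∈ lower i i<k with ℕ.m≤n⇒m<n∨m≡n i<k
    ... | inj₁ 1+i<k  = lower (suc i) 1+i<k
    ... | inj₂ ≡.refl = resp (trans (*-congʳ 1#-homo) (*-identityˡ _))
      (leading-mem u t k 0∈ (zero-mul t) lower)

    x-stable : Stable monomials x
    x-stable k = let i , j = remQuot {m} n k in
      resp (*-assoc _ _ _)
        (next x m (y ^ toℕ j) 0∈₁ (λ i′ i′<m → monomial i′ _ i′<m (toℕ<n j))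
          (toℕ i) (toℕ<n i))

    y-stable : Stable monomials y
    y-stable k = let i , j = remQuot {m} n k in
      resp (solve 3 (λ y a b → y :* a :* b := y :* (b :* a)) refl _ _ _)
        (next y n (x ^ toℕ i) 0∈₂
          (λ j′ j′<n → resp (*-comm _ _) (monomial _ j′ (toℕ<n i) j′<n))
          (toℕ j) (toℕ<n j))

    1∈Span : 1# ∈ Span monomials
    -- If `m` or `n` is 0 there are no monomials, but then a monic equation of degree 0 says that 0
    -- equals 1.
    1∈Span with m ℕ.≟ 0 | n ℕ.≟ 0
    ... | yes ≡.refl | _ = resp (trans 0∈₁ 1#-homo) 0-mem
    ... | no _ | yes ≡.refl = resp (trans 0∈₂ 1#-homo) 0-mem
    ... | no m≢0 | no n≢0 = resp (*-identityˡ 1#)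
      (monomial 0 0 (ℕ.n≢0⇒n>0 m≢0) (ℕ.n≢0⇒n>0 n≢0))

  integral-+ : ∀ {x y} → Integral x → Integral y → Integral (x + y)
  integral-+ (m , 0∈₁) (n , 0∈₂) = stable⇒integral monomials 1∈Span
    (stable-+ monomials x-stable y-stable)
    where open Monomials m n 0∈₁ 0∈₂

  integral-* : ∀ {x y} → Integral x → Integral y → Integral (x * y)
  integral-* (m , 0∈₁) (n , 0∈₂) = stable⇒integral monomials 1∈Span
    (stable-* monomials x-stable y-stable)
    where open Monomials m n 0∈₁ 0∈₂

-- Integers inside the rationals, and Bézout modulo a prime

ℤ→ℚ-homo : RingMorphisms.IsRingHomomorphism ℤ.+-*-rawRing ℚ.+-*-rawRing (ℚ._/ 1)
ℤ→ℚ-homo = record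
  { isSemiringHomomorphism = record
    { isNearSemiringHomomorphism = record
      { +-isMonoidHomomorphism = record
        { isMagmaHomomorphism = record
          { isRelHomomorphism = record { cong = ≡.cong (ℚ._/ 1) }
          ; homo = λ a b → ℚ.toℚᵘ-injective (begin
              ℚ.toℚᵘ ((a ℤ.+ b) ℚ./ 1) ≈⟨ /1 (a ℤ.+ b) ⟩
              ℚᵘ.mkℚᵘ (a ℤ.+ b) 0
                ≈⟨ ℚᵘ.≃-reflexive (≡.cong₂ (λ a b → ℚᵘ.mkℚᵘ (a ℤ.+ b) 0)
                     (ℤ.*-identityʳ a) (ℤ.*-identityʳ b)) ⟨
              ℚᵘ.mkℚᵘ a 0 ℚᵘ.+ ℚᵘ.mkℚᵘ b 0
                ≈⟨ ℚᵘ.+-cong (/1 a) (/1 b) ⟨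
              ℚ.toℚᵘ (a ℚ./ 1) ℚᵘ.+ ℚ.toℚᵘ (b ℚ./ 1)
                ≈⟨ ℚ.toℚᵘ-homo-+ (a ℚ./ 1) (b ℚ./ 1) ⟨
              ℚ.toℚᵘ (a ℚ./ 1 ℚ.+ b ℚ./ 1) ∎)
          }
        ; ε-homo = ≡.refl
        }
      ; *-homo = λ a b → ℚ.toℚᵘ-injective (begin
          ℚ.toℚᵘ ((a ℤ.* b) ℚ./ 1)     ≈⟨ /1 (a ℤ.* b) ⟩
          ℚᵘ.mkℚᵘ a 0 ℚᵘ.* ℚᵘ.mkℚᵘ b 0 ≈⟨ ℚᵘ.*-cong (/1 a) (/1 b) ⟨
          ℚ.toℚᵘ (a ℚ./ 1) ℚᵘ.* ℚ.toℚᵘ (b ℚ./ 1)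
            ≈⟨ ℚ.toℚᵘ-homo-* (a ℚ./ 1) (b ℚ./ 1) ⟨
          ℚ.toℚᵘ ((a ℚ./ 1) ℚ.* (b ℚ./ 1)) ∎)
      }
    ; 1#-homo = ≡.refl
    }
  ; -‿homo = λ a → ℚ.toℚᵘ-injective (begin
      ℚ.toℚᵘ ((ℤ.- a) ℚ./ 1)    ≈⟨ /1 (ℤ.- a) ⟩
      ℚᵘ.- ℚᵘ.mkℚᵘ a 0          ≈⟨ ℚᵘ.-‿cong (/1 a) ⟨
      ℚᵘ.- ℚ.toℚᵘ (a ℚ./ 1)     ≈⟨ ℚ.toℚᵘ-homo‿- (a ℚ./ 1) ⟨
      ℚ.toℚᵘ (ℚ.- (a ℚ./ 1))    ∎)
  }
  where
  open SetoidReasoning ℚᵘ.≃-setoid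
  /1 : ∀ a → ℚ.toℚᵘ (a ℚ./ 1) ℚᵘ.≃ ℚᵘ.mkℚᵘ a 0
  /1 a = ℚ.toℚᵘ-fromℚᵘ (ℚᵘ.mkℚᵘ a 0)

bézout : ∀ {p} → Prime p → ∀ c → ¬ p ∣ ℤ.∣ c ∣ →
         ∃[ a ] ∃[ b ] a ℤ.* c ℤ.+ b ℤ.* + p ≡ 1ℤ
bézout {p} p-prime c p∤c = go c (coprime-Bézout coprime)
  where
  coprime : Coprime ℤ.∣ c ∣ p
  coprime (d∣c , d∣p) with prime⇒irreducible p-prime d∣p
  ... | inj₁ d≡1    = d≡1
  ... | inj₂ ≡.refl = contradiction d∣c p∤c

  difference : ∀ x m y n → 1 ℕ.+ y ℕ.* n ≡ x ℕ.* m →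
               + x ℤ.* + m ℤ.+ (ℤ.- + y) ℤ.* + n ≡ 1ℤ
  difference x m y n eq = ≡.trans
    (≡.cong₂ ℤ._+_
      (≡.trans (≡.sym (ℤ.pos-* x m))
        (≡.trans (≡.cong +_ (≡.sym eq)) (≡.cong (λ z → 1ℤ ℤ.+ z) (ℤ.pos-* y n))))
      (≡.sym (ℤ.neg-distribˡ-* (+ y) (+ n))))
    (≡.trans (ℤ.+-assoc 1ℤ (+ y ℤ.* + n) (ℤ.- (+ y ℤ.* + n)))
      (≡.cong (λ z → 1ℤ ℤ.+ z) (ℤ.+-inverseʳ (+ y ℤ.* + n))))

  natural : ∀ m → Bézout.Identity 1 m p →
            ∃[ a ] ∃[ b ] a ℤ.* + m ℤ.+ b ℤ.* + p ≡ 1ℤ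
  natural m (Bézout.+- x y eq) = + x , ℤ.- + y , difference x m y p eq
  natural m (Bézout.-+ x y eq) = ℤ.- + x , + y ,
    ≡.trans (ℤ.+-comm ((ℤ.- + x) ℤ.* + m) (+ y ℤ.* + p)) (difference y p x m eq)

  go : ∀ c → Bézout.Identity 1 ℤ.∣ c ∣ p →
       ∃[ a ] ∃[ b ] a ℤ.* c ℤ.+ b ℤ.* + p ≡ 1ℤ
  go (+ m)      i = natural m i
  go (-[1+ m ]) i with natural (suc m) i
  ... | a , b , eq = ℤ.- a , b ,
    ≡.trans
      (≡.cong (ℤ._+ b ℤ.* + p) (≡.trans
        (≡.sym (ℤ.neg-distribˡ-* a -[1+ m ])) (ℤ.neg-distribʳ-* a -[1+ m ])))
      eq

-- The ring of integers and its ideals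

module Ideals (K : NumberField) where

  open NumberField K hiding (zero)
  open Sum semiring using (sum-cong-≋; *-distribˡ-sum)
  open SetoidReasoning setoid

  fromℤ-homo : RingMorphisms.IsRingHomomorphism ℤ.+-*-rawRing rawRing fromℤ
  fromℤ-homo = Composition.isRingHomomorphism trans ℤ→ℚ-homo fromℚ-homo

  module Int = Integrality commutativeRing fromℤ fromℤ-homo
  open Int public
    using (Poly; solve; _:=_; _:+_; _:*_; _:-_; :-_; con)

  𝒪⇒Integral : ∀ {x} → x ∈ 𝒪 → Int.Integral x
  𝒪⇒Integral {x} (n , c , eq) = n , Int.Poly-resp n
    (trans (+-congʳ (trans (*-congʳ Int.1#-homo) (*-identityˡ _))) eq)
    (Int.toPoly x n 1ℤ c)

  Integral⇒𝒪 : ∀ {x} → Int.Integral x → x ∈ 𝒪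
  Integral⇒𝒪 {x} (n , 0∈) =
    let c , eq = Int.fromPoly x n 0∈
    in n , c , sym (trans eq
         (+-congʳ (trans (*-congʳ Int.1#-homo) (*-identityˡ _))))

  𝒪-resp : ∀ {x y} → x ≈ y → x ∈ 𝒪 → y ∈ 𝒪
  𝒪-resp x≈y x∈ = Integral⇒𝒪 (Int.integral-resp x≈y (𝒪⇒Integral x∈))

  fromℤ∈𝒪 : ∀ c → fromℤ c ∈ 𝒪
  fromℤ∈𝒪 c = Integral⇒𝒪 (Int.φ-integral c)

  1∈𝒪 : 1# ∈ 𝒪
  1∈𝒪 = 𝒪-resp Int.1#-homo (fromℤ∈𝒪 1ℤ)

  𝒪-+ : ∀ {x y} → x ∈ 𝒪 → y ∈ 𝒪 → x + y ∈ 𝒪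
  𝒪-+ x∈ y∈ = Integral⇒𝒪 (Int.integral-+ (𝒪⇒Integral x∈) (𝒪⇒Integral y∈))

  𝒪-* : ∀ {x y} → x ∈ 𝒪 → y ∈ 𝒪 → x * y ∈ 𝒪
  𝒪-* x∈ y∈ = Integral⇒𝒪 (Int.integral-* (𝒪⇒Integral x∈) (𝒪⇒Integral y∈))

  𝒪-^ : ∀ {x} → x ∈ 𝒪 → ∀ n → x ^ n ∈ 𝒪
  𝒪-^ x∈ zero    = 1∈𝒪
  𝒪-^ x∈ (suc n) = 𝒪-* x∈ (𝒪-^ x∈ n)

  Poly⊆𝒪 : ∀ {x} → x ∈ 𝒪 → ∀ d {l} → Poly x d l ⊆ 𝒪
  Poly⊆𝒪 x∈ zero {l} y≈ = 𝒪-resp (sym y≈) (fromℤ∈𝒪 l)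
  Poly⊆𝒪 x∈ (suc d) (c , z , z∈ , y≈) =
    𝒪-resp (sym y≈) (𝒪-+ (fromℤ∈𝒪 c) (𝒪-* x∈ (Poly⊆𝒪 x∈ d z∈)))

  -- Has to cover products of primes, and `𝒪` as the empty product.
  record IsIdeal (I : Pred Carrier 0ℓ) : Set where
    field
      ⊆𝒪       : I ⊆ 𝒪
      resp-≈   : ∀ {x y} → x ≈ y → x ∈ I → y ∈ I
      0∈       : 0# ∈ I
      +-closed : ∀ {x y} → x ∈ I → y ∈ I → x + y ∈ I
      *-closed : ∀ {r x} → r ∈ 𝒪 → x ∈ I → r * x ∈ I

    sum-closed : ∀ {n} (f : Vector Carrier n) → (∀ i → f i ∈ I) → sum f ∈ I
    sum-closed {zero}  f f∈ = 0∈
    sum-closed {suc n} f f∈ = +-closed (f∈ zero) (sum-closed (f ∘ suc) (f∈ ∘ suc))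

    *-closedʳ : ∀ {r x} → x ∈ I → r ∈ 𝒪 → x * r ∈ I
    *-closedʳ x∈ r∈ = resp-≈ (*-comm _ _) (*-closed r∈ x∈)

    neg-closed : ∀ {x} → x ∈ I → - x ∈ I
    neg-closed x∈ = resp-≈
      (solve 1 (λ x → con -[1+ 0 ] :* x := :- x) refl _)
      (*-closed (fromℤ∈𝒪 -[1+ 0 ]) x∈)

  prime⇒ideal : ∀ {I} → IsPrimeIdeal K I → IsIdeal I
  prime⇒ideal I-prime = record { IsPrimeIdeal I-prime }

  𝒪-isIdeal : IsIdeal 𝒪
  𝒪-isIdeal = record
    { ⊆𝒪 = λ x∈ → x∈ ; resp-≈ = 𝒪-resp
    ; 0∈ = 𝒪-resp Int.0#-homo (fromℤ∈𝒪 0ℤ) ; +-closed = 𝒪-+ ; *-closed = 𝒪-* }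

  module _ {I J : Pred Carrier 0ℓ} (I-ideal : IsIdeal I) (J-ideal : IsIdeal J) where

    private
      module I = IsIdeal I-ideal
      module J = IsIdeal J-ideal

    product-∷ : ∀ {a b y} → a ∈ I → b ∈ J → y ∈ idealProduct K I J →
                a * b + y ∈ idealProduct K I J
    product-∷ a∈ b∈ (n , as , bs , as∈ , bs∈ , y≈) =
      suc n , _ ∷ as , _ ∷ bs ,
      (λ { zero → a∈ ; (suc i) → as∈ i }) ,
      (λ { zero → b∈ ; (suc i) → bs∈ i }) ,
      +-congˡ y≈

    product-resp : ∀ {x y} → x ≈ y → x ∈ idealProduct K I J → y ∈ idealProduct K I J
    product-resp x≈y (n , as , bs , as∈ , bs∈ , x≈) =
      n , as , bs , as∈ , bs∈ , trans (sym x≈y) x≈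

    product-0 : 0# ∈ idealProduct K I J
    product-0 = 0 , (λ ()) , (λ ()) , (λ ()) , (λ ()) , refl

    *∈product : ∀ {a b} → a ∈ I → b ∈ J → a * b ∈ idealProduct K I J
    *∈product a∈ b∈ =
      product-resp (+-identityʳ _) (product-∷ a∈ b∈ product-0)

    product-+ : ∀ {x y} → x ∈ idealProduct K I J → y ∈ idealProduct K I J →
                x + y ∈ idealProduct K I J
    product-+ {y = y} (n , as , bs , as∈ , bs∈ , x≈) y∈ =
      product-resp (+-congʳ (sym x≈)) (go n as bs as∈ bs∈)
      where
      go : ∀ n (as bs : Vector Carrier n) → (∀ i → as i ∈ I) → (∀ i → bs i ∈ J) →
           sum (λ i → as i * bs i) + y ∈ idealProduct K I J
      go zero    as bs as∈ bs∈ = product-resp (sym (+-identityˡ y)) y∈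
      go (suc n) as bs as∈ bs∈ = product-resp (sym (+-assoc _ _ _))
        (product-∷ (as∈ zero) (bs∈ zero)
          (go n (as ∘ suc) (bs ∘ suc) (as∈ ∘ suc) (bs∈ ∘ suc)))

    product⊆ʳ : idealProduct K I J ⊆ J
    product⊆ʳ (n , as , bs , as∈ , bs∈ , x≈) = J.resp-≈ (sym x≈)
      (J.sum-closed (λ i → as i * bs i) (λ i → J.*-closed (I.⊆𝒪 (as∈ i)) (bs∈ i)))

    product⊆ˡ : idealProduct K I J ⊆ I
    product⊆ˡ (n , as , bs , as∈ , bs∈ , x≈) = I.resp-≈ (sym x≈)
      (I.sum-closed (λ i → as i * bs i) (λ i → I.*-closedʳ (as∈ i) (J.⊆𝒪 (bs∈ i))))

    product-isIdeal : IsIdeal (idealProduct K I J)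
    product-isIdeal = record
      { ⊆𝒪 = J.⊆𝒪 ∘ product⊆ʳ ; resp-≈ = product-resp ; 0∈ = product-0
      ; +-closed = product-+
      ; *-closed = λ { {r} r∈ (n , as , bs , as∈ , bs∈ , x≈) →
          n , (λ i → r * as i) , bs , (λ i → I.*-closed r∈ (as∈ i)) , bs∈ ,
          trans (*-congˡ x≈) (trans (*-distribˡ-sum r (λ i → as i * bs i))
            (sum-cong-≋ {x = λ i → r * (as i * bs i)}
              (λ i → sym (*-assoc r (as i) (bs i))))) }
      }

  ∏ : ∀ {n} → Vector (Pred Carrier 0ℓ) n → Pred Carrier 0ℓ
  ∏ = foldr (idealProduct K) 𝒪

  ∏-isIdeal : ∀ {n} (P : Vector (Pred Carrier 0ℓ) n) → (∀ i → IsIdeal (P i)) →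
              IsIdeal (∏ P)
  ∏-isIdeal {zero}  P P-ideal = 𝒪-isIdeal
  ∏-isIdeal {suc n} P P-ideal =
    product-isIdeal (P-ideal zero) (∏-isIdeal (P ∘ suc) (P-ideal ∘ suc))

  ∏⊆ : ∀ {n} (P : Vector (Pred Carrier 0ℓ) n) → (∀ i → IsIdeal (P i)) →
       ∀ i → ∏ P ⊆ P i
  ∏⊆ P P-ideal zero =
    product⊆ˡ (P-ideal zero) (∏-isIdeal (P ∘ suc) (P-ideal ∘ suc))
  ∏⊆ P P-ideal (suc i) = ∏⊆ (P ∘ suc) (P-ideal ∘ suc) i ∘
    product⊆ʳ (P-ideal zero) (∏-isIdeal (P ∘ suc) (P-ideal ∘ suc))

  Comaximal : Pred Carrier 0ℓ → Pred Carrier 0ℓ → Set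
  Comaximal I J = ∃[ a ] ∃[ b ] a ∈ I × b ∈ J × a + b ≈ 1#

  -- Multiply the two decompositions of 1: in `(a + b) * (c + d)` every term but `b * d` has a
  -- factor in `I`, and `b * d` lies in the product.
  comaximal-∏ : ∀ {n I} (P : Vector (Pred Carrier 0ℓ) n) → IsIdeal I →
                (∀ i → IsIdeal (P i)) → (∀ i → Comaximal I (P i)) →
                Comaximal I (∏ P)
  comaximal-∏ {zero} P I-ideal P-ideal comax =
    0# , 1# , IsIdeal.0∈ I-ideal , 1∈𝒪 , +-identityˡ 1#
  comaximal-∏ {suc n} {I} P I-ideal P-ideal comax
    with comax zero | comaximal-∏ (P ∘ suc) I-ideal (P-ideal ∘ suc) (comax ∘ suc)
  ... | a , b , a∈ , b∈ , a+b≈1 | c , d , c∈ , d∈ , c+d≈1 =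
    a * (c + d) + b * c , b * d ,
    I.+-closed
      (I.*-closedʳ a∈ (𝒪-+ (I.⊆𝒪 c∈) (IsIdeal.⊆𝒪 ∏-ideal d∈)))
      (I.*-closed (IsIdeal.⊆𝒪 (P-ideal zero) b∈) c∈) ,
    *∈product (P-ideal zero) ∏-ideal b∈ d∈ ,
    (begin
      a * (c + d) + b * c + b * d
        ≈⟨ solve 4 (λ a b c d →
             a :* (c :+ d) :+ b :* c :+ b :* d := (a :+ b) :* (c :+ d))
             refl a b c d ⟩
      (a + b) * (c + d) ≈⟨ *-cong a+b≈1 c+d≈1 ⟩
      1# * 1#           ≈⟨ *-identityˡ 1# ⟩
      1# ∎)
    where
    module I = IsIdeal I-ideal
    ∏-ideal = ∏-isIdeal (P ∘ suc) (P-ideal ∘ suc)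

  -- With `a + b = 1`, `a` in the first ideal and `b` in the product of the others, `x = a x + x b`,
  -- and each term has one factor in either ideal. Integrality of `x` settles the empty product.
  ∩⊆∏ : ∀ {n} (P : Vector (Pred Carrier 0ℓ) n) → (∀ i → IsIdeal (P i)) →
        (∀ i j → i ≢ j → Comaximal (P i) (P j)) →
        ∀ {x} → x ∈ 𝒪 → (∀ i → x ∈ P i) → x ∈ ∏ P
  ∩⊆∏ {zero}  P P-ideal comax x∈𝒪 x∈ = x∈𝒪
  ∩⊆∏ {suc n} P P-ideal comax {x} x∈𝒪 x∈
    with comaximal-∏ (P ∘ suc) (P-ideal zero) (P-ideal ∘ suc)
           (λ i → comax zero (suc i) λ ())
  ... | a , b , a∈ , b∈ , a+b≈1 = product-resp (P-ideal zero) ∏-ideal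
    (begin
      a * x + x * b
        ≈⟨ solve 3 (λ a b x → a :* x :+ x :* b := (a :+ b) :* x) refl a b x ⟩
      (a + b) * x   ≈⟨ *-congʳ a+b≈1 ⟩
      1# * x        ≈⟨ *-identityˡ x ⟩
      x ∎)
    (product-+ (P-ideal zero) ∏-ideal
      (*∈product (P-ideal zero) ∏-ideal a∈
        (∩⊆∏ (P ∘ suc) (P-ideal ∘ suc)
          (λ i j i≢j → comax (suc i) (suc j) (i≢j ∘ suc-injective))
          x∈𝒪 (x∈ ∘ suc)))
      (*∈product (P-ideal zero) ∏-ideal (x∈ zero) b∈))
    where ∏-ideal = ∏-isIdeal (P ∘ suc) (P-ideal ∘ suc)

  -- Descends along a monic integral equation of x: as long as the constant
  -- coefficient is divisible by p, the factor x can be cancelled modulo J,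
  -- and otherwise that coefficient is invertible modulo p.
  comaximal : ∀ {p I J x} → Prime p → IsIdeal I → IsPrimeIdeal K J →
              fromℤ (+ p) ∈ J → x ∈ I → x ∉ J → Comaximal I J
  comaximal {p} {I} {J} {x} p-prime I-ideal J-prime p∈J x∈I x∉J =
    let n , 0∈ = 𝒪⇒Integral x∈𝒪 in descend n 0∈ J.0∈
    where
    module I = IsIdeal I-ideal
    module J = IsPrimeIdeal J-prime
    module J′ = IsIdeal (prime⇒ideal J-prime)
    x∈𝒪 = I.⊆𝒪 x∈I

    descend : ∀ d {z} → z ∈ Poly x d 1ℤ → z ∈ J → Comaximal I J
    -- Had every step cancelled `x`, the leading coefficient 1 would lie in `J`; so the other branch
    -- must occur.
    descend zero z≈ z∈J = contradiction (J.resp-≈ (trans z≈ Int.1#-homo) z∈J) J.1∉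
    descend (suc d) {z} (c , w , w∈ , z≈) z∈J with p ∣? ℤ.∣ c ∣
    ... | yes p∣c with ∣ᵤ⇒∣ {+ p} {c} p∣c
    ...   | divides q ≡.refl =
      cancel (J.prime x∈𝒪 (Poly⊆𝒪 x∈𝒪 d w∈) (J.resp-≈
        (begin
          z - φc               ≈⟨ +-congʳ z≈ ⟩
          fromℤ c + x * w - φc ≈⟨ +-congˡ (-‿cong (sym (Int.*-homo q (+ p)))) ⟩
          fromℤ c + x * w - fromℤ c
            ≈⟨ solve 2 (λ c y → c :+ y :- c := y) refl (fromℤ c) (x * w) ⟩
          x * w ∎)
        (J.+-closed z∈J (J′.neg-closed (J.*-closed (fromℤ∈𝒪 q) p∈J)))))
      where
      φc = fromℤ q * fromℤ (+ p)
      cancel : x ∈ J ⊎ w ∈ J → Comaximal I J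
      cancel (inj₁ x∈J) = contradiction x∈J x∉J
      cancel (inj₂ w∈J) = descend d w∈ w∈J
    descend (suc d) {z} (c , w , w∈ , z≈) z∈J | no p∤c with bézout p-prime c p∤c
    ... | a , b , eq =
      -- From `z = c + x w` and `a c + b p = 1` follows `a z + b p = 1 + a x w`, whose left side
      -- lies in `J`.
      - (fromℤ a * (w * x)) , fromℤ a * z + fromℤ b * fromℤ (+ p) ,
      I.neg-closed (I.*-closed (fromℤ∈𝒪 a) (I.*-closed (Poly⊆𝒪 x∈𝒪 d w∈) x∈I)) ,
      J.+-closed (J.*-closed (fromℤ∈𝒪 a) z∈J) (J.*-closed (fromℤ∈𝒪 b) p∈J) ,
      (begin
        - (fromℤ a * (w * x)) + (fromℤ a * z + fromℤ b * fromℤ (+ p))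
          ≈⟨ +-congˡ (+-congʳ (*-congˡ z≈)) ⟩
        - (fromℤ a * (w * x)) +
          (fromℤ a * (fromℤ c + x * w) + fromℤ b * fromℤ (+ p))
          ≈⟨ solve 5 (λ a w x c t →
               :- (a :* (w :* x)) :+ (a :* (c :+ x :* w) :+ t) := a :* c :+ t)
               refl _ _ _ _ _ ⟩
        fromℤ a * fromℤ c + fromℤ b * fromℤ (+ p)
          ≈⟨ +-cong (Int.*-homo a c) (Int.*-homo b (+ p)) ⟨
        fromℤ (a ℤ.* c) + fromℤ (b ℤ.* + p) ≈⟨ Int.+-homo (a ℤ.* c) (b ℤ.* + p) ⟨
        fromℤ (a ℤ.* c ℤ.+ b ℤ.* + p)       ≈⟨ reflexive (≡.cong fromℤ eq) ⟩
        fromℤ 1ℤ                            ≈⟨ Int.1#-homo ⟩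
        1# ∎)

-- Apartness from zero in Heyting fields

module FieldProperties (F : Field) where
  open FieldOps F hiding (zero)
  private
    module H = HeytingProperties heytingCommutativeRing
  open H public using (#-congʳ; x#0y#0→xy#0; 1#0)

  *≈1⇒#0 : ∀ {x y} → x * y ≈ 1# → x # 0#
  *≈1⇒#0 {x} {y} xy≈1 =
    H.invertibleʳ⇒# (y , trans (*-congʳ (H.x-0≈x x)) xy≈1)

  #0⇒inverse : ∀ {x} → x # 0# → ∃[ y ] x * y ≈ 1#
  #0⇒inverse {x} x#0 =
    let y , _ , xy≈1 = #⇒invertible x#0
    in y , trans (*-congʳ (sym (H.x-0≈x x))) xy≈1

  *#0⇒#0ˡ : ∀ {x y} → x * y # 0# → x # 0#
  *#0⇒#0ˡ xy#0 = let z , xyz≈1 = #0⇒inverse xy#0 in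
    *≈1⇒#0 (trans (sym (*-assoc _ _ z)) xyz≈1)

  *#0⇒#0ʳ : ∀ {x y} → x * y # 0# → y # 0#
  *#0⇒#0ʳ xy#0 = *#0⇒#0ˡ (#-congʳ (*-comm _ _) xy#0)

-- Completions and principal local units

module CompletionProperties (K : NumberField) {𝔭 : Pred (NumberField.Carrier K) 0ℓ}
  (𝔭-prime : IsPrimeIdeal K 𝔭) (C : Completion K 𝔭) where

  private
    module K = NumberField K
    module 𝔭 = IsPrimeIdeal 𝔭-prime
  open Ideals K using (module IsIdeal; fromℤ-homo; 1∈𝒪; 𝒪-+; 𝒪-isIdeal;
    prime⇒ideal; product-resp; *∈product; product⊆ˡ)
  open Completion C
  open ^
  open FieldProperties field^
  open RingMorphisms.IsRingHomomorphism ι-homo public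
    using () renaming (⟦⟧-cong to ι-cong; +-homo to ι-+; *-homo to ι-*;
      -‿homo to ι-neg; 1#-homo to ι-1)
  private
    module I = Integrality commutativeRing (ι ∘ K.fromℤ)
      (Composition.isRingHomomorphism trans fromℤ-homo ι-homo)
  open I using (solve; _:=_; _:+_; _:-_)
  open SetoidReasoning setoid

  ι-^ : ∀ x n → ι (x K.^ n) ≈ ι x ^ n
  ι-^ x zero    = ι-1
  ι-^ x (suc n) = trans (ι-* _ _) (*-congˡ (ι-^ x n))

  ι-sub : ∀ x y → ι (x K.- y) ≈ ι x - ι y
  ι-sub x y = trans (ι-+ x (K.- y)) (+-congˡ (ι-neg y))

  ι-#0 : ∀ {x y} → x K.* y K.≈ K.1# → ι x # 0#
  ι-#0 xy≈1 = *≈1⇒#0 (trans (sym (ι-* _ _)) (trans (ι-cong xy≈1) ι-1))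

  -- By tightness it is enough to refute `x # y`. Apartness makes `x - y` invertible, and then so is
  -- its image, which is 0.
  ι-injective : ∀ {x y} → ι x ≈ ι y → x K.≈ y
  ι-injective {x} {y} ιx≈ιy = proj₁ (K.tight x y) λ x#y →
    let z , _ , eq = K.#⇒invertible x#y
    in #-irrefl (begin
         ι (x K.- y)   ≈⟨ ι-sub x y ⟩
         ι x - ι y     ≈⟨ +-congʳ ιx≈ιy ⟩
         ι y - ι y     ≈⟨ -‿inverseʳ _ ⟩
         0# ∎) (ι-#0 eq)

  Val≥-resp : ∀ {n x y} → x ≈ y → Val≥ n x → Val≥ n y
  Val≥-resp {n} x≈y x≥n y#0 =
    let x#0 = #-congʳ (sym x≈y) y#0
    in ≡.subst (n ℤ.≤_) (val-cong x#0 y#0 x≈y) (x≥n x#0)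

  Val≥-* : ∀ {m n x y} → Val≥ m x → Val≥ n y → Val≥ (m ℤ.+ n) (x * y)
  Val≥-* {m} {n} x≥m y≥n xy#0 =
    let x#0 = *#0⇒#0ˡ xy#0
        y#0 = *#0⇒#0ʳ xy#0
    in ≡.subst (m ℤ.+ n ℤ.≤_) (≡.sym (val-* x#0 y#0 xy#0))
         (ℤ.+-mono-≤ (x≥m x#0) (y≥n y#0))

  𝔪-* : ∀ {x y} → x ∈ 𝔪 → y ∈ 𝔪 → x * y ∈ 𝔪
  𝔪-* x∈ y∈ xy#0 = ℤ.≤-trans (+≤+ (s≤s z≤n)) (Val≥-* x∈ y∈ xy#0)

  0∈𝔪 : 0# ∈ 𝔪
  0∈𝔪 0#0 = contradiction 0#0 (#-irrefl refl)

  Near-≈ : ∀ N {x y} → x ≈ y → Near N x y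
  Near-≈ N {x} {y} x≈y x-y#0 =
    contradiction x-y#0 (#-irrefl (trans (+-congʳ x≈y) (-‿inverseʳ y)))

  -- The condition that `U` imposes at a single prime; `U` is closed under an operation once this
  -- is.
  PrincipalUnit : Pred Carrier 0ℓ
  PrincipalUnit u = u # 0# × (∃[ x ] x ∈ 𝔪 × u ≈ 1# + x)

  PrincipalUnit-* : ∀ {u v} → u ∈ PrincipalUnit → v ∈ PrincipalUnit →
                    u * v ∈ PrincipalUnit
  PrincipalUnit-* (u#0 , x , x∈ , u≈) (v#0 , y , y∈ , v≈) =
    x#0y#0→xy#0 u#0 v#0 , x + (y + x * y) ,
    val-+ _ x∈ (val-+ _ y∈ (𝔪-* x∈ y∈)) ,
    trans (*-cong u≈ v≈)
      (trans (distribʳ _ _ _) (trans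
        (+-cong (*-identityˡ _) (trans (distribˡ _ _ _) (+-congʳ (*-identityʳ _))))
        (solve 4 (λ i x y z → i :+ y :+ (x :+ z) := i :+ (x :+ (y :+ z)))
          refl 1# x y (x * y))))

  PrincipalUnit-^ : ∀ {u} → u ∈ PrincipalUnit → ∀ n → u ^ n ∈ PrincipalUnit
  PrincipalUnit-^ u∈ zero    = 1#0 , 0# , 0∈𝔪 , sym (+-identityʳ 1#)
  PrincipalUnit-^ u∈ (suc n) = PrincipalUnit-* u∈ (PrincipalUnit-^ u∈ n)

  ι-PrincipalUnit : ∀ {x y} → x K.* y K.≈ K.1# → x K.- K.1# ∈ 𝔭 →
                    ι x ∈ PrincipalUnit
  ι-PrincipalUnit {x} xy≈1 x-1∈ = ι-#0 xy≈1 , ι (x K.- K.1#) ,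
    Equivalence.to (extends 1 (𝔭.⊆𝒪 x-1∈))
      -- The first power of `𝔭` is by definition the product of `𝔭` and `𝒪`, so the element is
      -- written as itself times 1.
      (product-resp (prime⇒ideal 𝔭-prime) 𝒪-isIdeal (K.*-identityʳ _)
        (*∈product (prime⇒ideal 𝔭-prime) 𝒪-isIdeal x-1∈ 1∈𝒪)) ,
    (begin
      ι x              ≈⟨ solve 2 (λ x i → x := i :+ (x :- i)) refl (ι x) 1# ⟩
      1# + (ι x - 1#)  ≈⟨ +-congˡ (+-congˡ (-‿cong ι-1)) ⟨
      1# + (ι x - ι K.1#) ≈⟨ +-congˡ (ι-sub x K.1#) ⟨
      1# + ι (x K.- K.1#) ∎)

  PrincipalUnit⇒∈𝔭 : ∀ {x} → x ∈ K.𝒪 → ι x ∈ PrincipalUnit → x K.- K.1# ∈ 𝔭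
  PrincipalUnit⇒∈𝔭 {x} x∈ (_ , y , y∈ , ιx≈) =
    product⊆ˡ (prime⇒ideal 𝔭-prime) 𝒪-isIdeal
      (Equivalence.from (extends 1 x-1∈𝒪) (Val≥-resp (begin
        y                  ≈⟨ solve 2 (λ y i → y := (i :+ y) :- i) refl y 1# ⟩
        1# + y - 1#        ≈⟨ +-cong ιx≈ (-‿cong ι-1) ⟨
        ι x - ι K.1#       ≈⟨ ι-sub x K.1# ⟨
        ι (x K.- K.1#) ∎) y∈))
    where
    x-1∈𝒪 : x K.- K.1# ∈ K.𝒪
    x-1∈𝒪 = 𝒪-+ x∈ (IsIdeal.neg-closed 𝒪-isIdeal 1∈𝒪)

-- Global units, roots of unity and torsion

module KummerLeopoldt (K : NumberField) {p : ℕ} (p-prime : Prime p)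
  (S : PrimesAbove K p) (C : ∀ i → Completion K (PrimesAbove.𝔭 S i)) where

  open NumberField K hiding (zero)
  open PrimesAbove S
  open Units K p S C
  open Ideals K
  open Exp (CommutativeRing.commutativeSemiring commutativeRing)
    using (^-congˡ; ^-congʳ; ^-assocʳ; ^-distrib-*)
  open SetoidReasoning setoid
  private
    module C i = Completion (C i)
    module L i = CompletionProperties K (isPrime i) (C i)
    module LExp i = Exp (CommutativeRing.commutativeSemiring (C.^.commutativeRing i))

    𝔭-isIdeal : ∀ i → IsIdeal (𝔭 i)
    𝔭-isIdeal i = prime⇒ideal (isPrime i)

    module ∏𝔭 = IsIdeal (∏-isIdeal 𝔭 𝔭-isIdeal)

    instance
      p≢0 : ℕ.NonZero p
      p≢0 = prime⇒nonZero p-prime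

  1^ : ∀ n → 1# ^ n ≈ 1#
  1^ zero    = refl
  1^ (suc n) = trans (*-identityˡ _) (1^ n)

  E-* : ∀ {ε η} → ε ∈ E → η ∈ E → ε * η ∈ E
  E-* {ε} {η} (ε∈ , (ε′ , ε′∈ , εε′≈1) , ε-1∈) (η∈ , (η′ , η′∈ , ηη′≈1) , η-1∈) =
    𝒪-* ε∈ η∈ ,
    (ε′ * η′ , 𝒪-* ε′∈ η′∈ , (begin
      ε * η * (ε′ * η′)
        ≈⟨ solve 4 (λ a b c d → a :* b :* (c :* d) := a :* c :* (b :* d))
             refl _ _ _ _ ⟩
      ε * ε′ * (η * η′) ≈⟨ *-cong εε′≈1 ηη′≈1 ⟩
      1# * 1#           ≈⟨ *-identityˡ 1# ⟩
      1# ∎)) ,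
    ∏𝔭.resp-≈
      (begin
        ε * (η - 1#) + (ε - 1#)
          ≈⟨ solve 3 (λ a b i →
               a :* (b :- i) :+ (a :- i) := a :* b :- a :* i :+ a :- i)
               refl ε η 1# ⟩
        ε * η - ε * 1# + ε - 1#
          ≈⟨ +-congʳ (+-congʳ (+-congˡ (-‿cong (*-identityʳ ε)))) ⟩
        ε * η - ε + ε - 1#
          ≈⟨ solve 3 (λ a b i → b :- a :+ a :- i := b :- i) refl ε (ε * η) 1# ⟩
        ε * η - 1# ∎)
      (∏𝔭.+-closed (∏𝔭.*-closed ε∈ η-1∈) ε-1∈)

  E-^ : ∀ {ε} → ε ∈ E → ∀ n → ε ^ n ∈ E
  E-^ ε∈ zero    = 1∈𝒪 , (1# , 1∈𝒪 , *-identityˡ 1#) ,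
    ∏𝔭.resp-≈ (sym (-‿inverseʳ 1#)) ∏𝔭.0∈
  E-^ ε∈ (suc n) = E-* ε∈ (E-^ ε∈ n)

  E-inverse : ∀ {ε} → ε ∈ E → ∃[ η ] η ∈ E × ε * η ≈ 1#
  E-inverse {ε} (ε∈ , (η , η∈ , εη≈1) , ε-1∈) =
    η , (η∈ , (ε , ε∈ , trans (*-comm η ε) εη≈1) ,
      ∏𝔭.resp-≈
        (begin
          - (η * (ε - 1#))
            ≈⟨ solve 3 (λ a b i → :- (b :* (a :- i)) := b :* i :- a :* b)
                 refl ε η 1# ⟩
          η * 1# - ε * η ≈⟨ +-cong (*-identityʳ η) (-‿cong εη≈1) ⟩
          η - 1# ∎)
        (∏𝔭.neg-closed (∏𝔭.*-closed η∈ ε-1∈))) ,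
    εη≈1

  E⊆U : ∀ {ε} → ε ∈ E → diag ε ∈ U
  E⊆U (_ , (_ , _ , εη≈1) , ε-1∈) i =
    L.ι-PrincipalUnit i εη≈1 (∏⊆ 𝔭 𝔭-isIdeal i ε-1∈)

  -- Integrality and invertibility come from the equation `ζ ^ p^k = 1`; the congruence to 1 is
  -- taken from the local hypothesis, one prime at a time.
  root-of-unity∈E : ∀ {ζ} → ζ ∈ μ → diag ζ ∈ U → ζ ∈ E
  root-of-unity∈E {ζ} (k , ζ^pᵏ≈1) diagζ∈U =
    ζ∈𝒪 , (ζ ^ m , 𝒪-^ ζ∈𝒪 m , ζζ^m≈1) ,
    ∩⊆∏ 𝔭 𝔭-isIdeal comax (𝒪-+ ζ∈𝒪 (IsIdeal.neg-closed 𝒪-isIdeal 1∈𝒪))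
      (λ i → L.PrincipalUnit⇒∈𝔭 i ζ∈𝒪 (diagζ∈U i))
    where
    m = ℕ.pred (p ℕ.^ k)

    ζζ^m≈1 : ζ * ζ ^ m ≈ 1#
    ζζ^m≈1 = trans
      (^-congʳ ζ (ℕ.suc-pred (p ℕ.^ k) {{ℕ.m^n≢0 p k}})) ζ^pᵏ≈1

    power : ∀ d → ζ ^ d ∈ Poly ζ d 1ℤ
    power zero    = sym Int.1#-homo
    power (suc d) = Int.Poly-shift d (power d)

    ζ∈𝒪 : ζ ∈ 𝒪
    -- The polynomial `X ^ (m + 1) - 1` in Horner form: constant coefficient -1, then `ζ` times the
    -- monic `ζ ^ m`.
    ζ∈𝒪 = Integral⇒𝒪 (suc m , -[1+ 0 ] , ζ ^ m , power m , (begin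
      0#                   ≈⟨ -‿inverseˡ 1# ⟨
      - 1# + 1#            ≈⟨ +-cong (-‿cong Int.1#-homo) ζζ^m≈1 ⟨
      - fromℤ 1ℤ + ζ * ζ ^ m ≈⟨ +-congʳ (Int.-‿homo 1ℤ) ⟨
      fromℤ -[1+ 0 ] + ζ * ζ ^ m ∎))

    comax : ∀ i j → i ≢ j → Comaximal (𝔭 i) (𝔭 j)
    comax i j i≢j = let x , x∈ , x∉ = distinct i j i≢j in
      comaximal p-prime (𝔭-isIdeal i) (isPrime j) (above j) x∈ x∉

  ^p-split : ∀ x m n → x ^ (p ℕ.^ (m ℕ.+ n)) ≈ (x ^ (p ℕ.^ m)) ^ (p ℕ.^ n)
  ^p-split x m n = trans (^-congʳ x (ℕ.^-distribˡ-+-* p m n))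
    (sym (^-assocʳ x (p ℕ.^ m) (p ℕ.^ n)))

  ^p-splitᴸ : ∀ u m n → u ^ᴸ (p ℕ.^ (m ℕ.+ n)) ≈ᴸ (u ^ᴸ (p ℕ.^ m)) ^ᴸ (p ℕ.^ n)
  ^p-splitᴸ u m n i = C.^.trans i
    (LExp.^-congʳ i (u i) (ℕ.^-distribˡ-+-* p m n))
    (C.^.sym i (LExp.^-assocʳ i (u i) (p ℕ.^ m) (p ℕ.^ n)))

  torsion∈W : ∀ {w} → w ∈ U → ∀ k → w ^ᴸ (p ℕ.^ k) ≈ᴸ 1ᴸ → w ∈ W
  torsion∈W {w} w∈U k w^pᵏ≈1 = w∈U ,
    -- A constant sequence represents the exponent `p ^ k`. It is not zero because `p ^ (k + 1)`
    -- fails to divide its term at index `k + 1`.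
    record
      { approx   = λ _ → p ℕ.^ k
      ; coherent = λ n → ≡.subst (p ℕ.^ n ∣_) (≡.sym (ℕ.∣n-n∣≡0 (p ℕ.^ k))) (_ ∣0)
      } ,
    (λ p^k≡0 → >⇒∤ {{ℕ.m^n≢0 p k}}
      (ℕ.^-monoʳ-< p (ℕ.nonTrivial⇒n>1 p {{prime⇒nonTrivial p-prime}}) (ℕ.n<1+n k))
      (p^k≡0 (suc k))) ,
    λ i N → 0 , λ _ _ → L.Near-≈ i N (w^pᵏ≈1 i)

  E∩U^-root : ∀ {κ} ((N , _) : KummerLeopoldtBound κ) n {ε} → ε ∈ E →
              diag ε ∈ U^ (p ℕ.^ (n ℕ.+ κ)) →
              ε ^ (p ℕ.^ N) ∈ E^ (p ℕ.^ (n ℕ.+ N))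
  E∩U^-root {κ} (N , bound) n {ε} ε∈E (u , u∈U , ε≈u) =
    -- `N` is the threshold in the bound itself, so `n + N` is past it for every `n`. The local
    -- exponents `n + κ + N` and `n + N + κ` agree.
    bound (n ℕ.+ N) (ℕ.m≤n+m N n) (ε ^ (p ℕ.^ N)) (E-^ ε∈E (p ℕ.^ N))
      (u , u∈U , λ i →
        C.^.trans i (L.ι-^ i ε (p ℕ.^ N))
        (C.^.trans i (LExp.^-congˡ i (p ℕ.^ N) (ε≈u i))
        (C.^.trans i (C.^.sym i (^p-splitᴸ u (n ℕ.+ κ) N i))
          (LExp.^-congʳ i (u i) exponent))))
    where
    exponent : p ℕ.^ (n ℕ.+ κ ℕ.+ N) ≡ p ℕ.^ (n ℕ.+ N ℕ.+ κ)
    exponent = ≡.cong (p ℕ.^_) (≡.trans (ℕ.+-assoc n κ N)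
      (≡.trans (≡.cong (n ℕ.+_) (ℕ.+-comm κ N)) (≡.sym (ℕ.+-assoc n N κ))))

  -- `θ` stands for the inverse of `η`, taken inside `E`, so that all quotients become products,
  -- globally and locally.
  module Quotient {κ n N : ℕ} {ε η θ : Carrier} {u : Local} (u∈U : u ∈ U)
    (ε≈u : diag ε ≈ᴸ u ^ᴸ (p ℕ.^ (n ℕ.+ κ)))
    (ε^≈η^ : ε ^ (p ℕ.^ N) ≈ η ^ (p ℕ.^ (n ℕ.+ N)))
    (θ∈E : θ ∈ E) (ηθ≈1 : η * θ ≈ 1#) where

    private
      q = p ℕ.^ n

    ζ : Carrier
    ζ = ε * θ ^ q

    η^θ^≈1 : ∀ k → η ^ k * θ ^ k ≈ 1#
    η^θ^≈1 k = begin
      η ^ k * θ ^ k ≈⟨ ^-distrib-* η θ k ⟨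
      (η * θ) ^ k   ≈⟨ ^-congˡ k ηθ≈1 ⟩
      1# ^ k        ≈⟨ 1^ k ⟩
      1# ∎

    ζ^≈1 : ζ ^ (p ℕ.^ N) ≈ 1#
    ζ^≈1 = begin
      ζ ^ (p ℕ.^ N)
        ≈⟨ ^-distrib-* ε (θ ^ q) (p ℕ.^ N) ⟩
      ε ^ (p ℕ.^ N) * (θ ^ q) ^ (p ℕ.^ N)
        ≈⟨ *-cong ε^≈η^ (sym (^p-split θ n N)) ⟩
      η ^ (p ℕ.^ (n ℕ.+ N)) * θ ^ (p ℕ.^ (n ℕ.+ N))
        ≈⟨ η^θ^≈1 (p ℕ.^ (n ℕ.+ N)) ⟩
      1# ∎

    ε≈ζη^ : ε ≈ ζ * η ^ q
    ε≈ζη^ = begin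
      ε                   ≈⟨ *-identityʳ ε ⟨
      ε * 1#              ≈⟨ *-congˡ (η^θ^≈1 q) ⟨
      ε * (η ^ q * θ ^ q) ≈⟨ *-congˡ (*-comm (η ^ q) (θ ^ q)) ⟩
      ε * (θ ^ q * η ^ q) ≈⟨ *-assoc ε (θ ^ q) (η ^ q) ⟨
      ζ * η ^ q ∎

    w : Local
    w i = C.^._*_ i ((u ^ᴸ (p ℕ.^ κ)) i) (diag θ i)

    ζ≈w^ : diag ζ ≈ᴸ w ^ᴸ q
    ζ≈w^ i = C.^.trans i (L.ι-* i ε (θ ^ q))
      (C.^.trans i
        (C.^.*-cong i
          (C.^.trans i (ε≈u i) (C.^.trans i
            (LExp.^-congʳ i (u i) (≡.cong (p ℕ.^_) (ℕ.+-comm n κ)))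
            (^p-splitᴸ u κ n i)))
          (L.ι-^ i θ q))
        (C.^.sym i (LExp.^-distrib-* i ((u ^ᴸ (p ℕ.^ κ)) i) (diag θ i) q)))

    w∈W : w ∈ W
    w∈W = torsion∈W
      (λ i → L.PrincipalUnit-* i
        (L.PrincipalUnit-^ i (u∈U i) (p ℕ.^ κ)) (E⊆U θ∈E i))
      -- Raising `w` to the power `p ^ n` gives `ζ`, and a further `p ^ N` gives 1.
      (n ℕ.+ N)
      (λ i → C.^.trans i (^p-splitᴸ w n N i)
        (C.^.trans i (LExp.^-congˡ i (p ℕ.^ N) (C.^.sym i (ζ≈w^ i)))
        (C.^.trans i (C.^.sym i (L.ι-^ i ζ (p ℕ.^ N)))
        (C.^.trans i (L.ι-cong i ζ^≈1) (L.ι-1 i)))))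

  -- Contains part (i), but exposes `w`, since part (ii) has to replace this very root of `ζ` by a
  -- global one.
  decompose : ∀ {κ} → KummerLeopoldtBound κ → ∀ n {ε} → ε ∈ E →
              diag ε ∈ U^ (p ℕ.^ (n ℕ.+ κ)) →
              ∃[ ζ ] ∃[ η ] ∃[ w ] ζ ∈ μ × η ∈ E × w ∈ W ×
              diag ζ ≈ᴸ w ^ᴸ (p ℕ.^ n) × ε ≈ ζ * η ^ (p ℕ.^ n)
  decompose {κ} bound@(N , _) n ε∈E ε∈U^@(u , u∈U , ε≈u) =
    let η , η∈E , ε^≈η^ = E∩U^-root bound n ε∈E ε∈U^
        θ , θ∈E , ηθ≈1 = E-inverse η∈E
        open Quotient {κ} {n} {N} u∈U ε≈u ε^≈η^ θ∈E ηθ≈1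
    in ζ , η , w , (N , ζ^≈1) , η∈E , w∈W , ζ≈w^ , ε≈ζη^

  W∩diag⊆E : ∀ {ξ w} → ξ ∈ μ → w ∈ W → w ≈ᴸ diag ξ → ξ ∈ E
  W∩diag⊆E ξ∈μ (w∈U , _) w≈ξ = root-of-unity∈E ξ∈μ λ i →
    let w#0 , x , x∈ , w≈ = w∈U i in
    FieldProperties.#-congʳ (C.field^ i) (w≈ξ i) w#0 , x , x∈ ,
    C.^.trans i (C.^.sym i (w≈ξ i)) w≈

  power-of-unit : ∀ {κ} → KummerLeopoldtBound κ → KillsW/μ 1 →
                  ∀ n {ε} → ε ∈ E → diag ε ∈ U^ (p ℕ.^ (n ℕ.+ κ)) →
                  ε ∈ E^ (p ℕ.^ n)
  power-of-unit bound W⊆μ n {ε} ε∈E ε∈U^ = cases (inhabited? count)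
    where
    q = p ℕ.^ n

    -- The equation between `ζ` and `ξ ^ q` is known only in the completions. It is pulled back to
    -- `K` through one of them, so an index must exist.
    inhabited? : ∀ k → Fin k ⊎ ¬ Fin k
    inhabited? zero    = inj₂ λ ()
    inhabited? (suc k) = inj₁ zero

    -- If there is no prime above p, then U is trivial and the bound says
    -- that every unit is a p ^ (N + n)-th power.
    cases : Fin count ⊎ ¬ Fin count → ε ∈ E^ q
    cases (inj₂ empty) =
      let N , root = bound
          η , η∈E , ε≈ = root (N ℕ.+ n) (ℕ.m≤m+n N n) ε ε∈E
            (diag ε , (λ i → contradiction i empty) , (λ i → contradiction i empty))
      in η ^ (p ℕ.^ N) , E-^ η∈E (p ℕ.^ N) , trans ε≈ (^p-split η N n)
    cases (inj₁ i) =
      let ζ , η , w , ζ∈μ , η∈E , w∈W , ζ≈w^ , ε≈ = decompose bound n ε∈E ε∈U^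
          ξ , ξ∈μ , w¹≈ξ = W⊆μ w w∈W
          w≈ξ : w ≈ᴸ diag ξ
          w≈ξ = λ j → C.^.trans j (C.^.sym j (C.^.*-identityʳ j (w j))) (w¹≈ξ j)
          ζ≈ξ^ = L.ι-injective i (C.^.trans i (ζ≈w^ i)
            (C.^.trans i (LExp.^-congˡ i q (w≈ξ i)) (C.^.sym i (L.ι-^ i ξ q))))
      in ξ * η , E-* (W∩diag⊆E ξ∈μ w∈W w≈ξ) η∈E , (begin
        ε             ≈⟨ ε≈ ⟩
        ζ * η ^ q     ≈⟨ *-congʳ ζ≈ξ^ ⟩
        ξ ^ q * η ^ q ≈⟨ ^-distrib-* ξ η q ⟨
        (ξ * η) ^ q ∎)

theorem3p1 : (K : NumberField) (p : ℕ) → Prime p →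
    (S : PrimesAbove K p) (C : ∀ i → Completion K (PrimesAbove.𝔭 S i)) →
    let open NumberField K
        open Units K p S C
    in
    Leopoldt →
    (κ : ℕ) → IsKummerLeopoldtConstant κ →
    (ν : ℕ) → IsExponentW/μ (p ℕ.^ ν) →
    ( 1 ℕ.≤ ν →
      ∀ n ε → ε ∈ E → diag ε ∈ U^ (p ℕ.^ (n ℕ.+ κ)) →
      ∃[ ζ ] ∃[ η ] (ζ ∈ μ × diag ζ ∈ W^ (p ℕ.^ n)) × η ∈ E ×
                    ε ≈ ζ * η ^ (p ℕ.^ n) )
    ×
    ( ν ≡ 0 →
      ∀ n ε → ε ∈ E → diag ε ∈ U^ (p ℕ.^ (n ℕ.+ κ)) →
      ε ∈ E^ (p ℕ.^ n) )
theorem3p1 K p p-prime S C _ κ (bound , _) ν (kills , _) =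
  (λ _ n ε ε∈E ε∈U^ →
    let ζ , η , w , ζ∈μ , η∈E , w∈W , ζ≈w^ , ε≈ = decompose bound n ε∈E ε∈U^
    in ζ , η , (ζ∈μ , w , w∈W , ζ≈w^) , η∈E , ε≈) ,
  -- For `ν = 0` the exponent `p ^ ν` computes to 1, so `kills` says that every element of `W` is a
  -- global root of unity.
  λ { ≡.refl n ε → power-of-unit bound kills n {ε} }
  where open KummerLeopoldt K p-prime S C
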